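{- Let $(\mathcal C,\partial)$ be the chain complex defined below, supported on $\Gamma(m,n)$. Then for each $i$, $H_i(\mathcal C,\partial;\mathbb Z)$ is free abelian with a basis given by the homology classes of the rook placements in $\mathcal R(m,n)$ of rank $i$ all of whose rooks lie on shaded squares of row $1$ (each of which is a cycle). Furthermore $$\sum_{i\ge0}\dim H_i(\mathcal C,\partial;\mathbb Z)\,q^i=q^{n(n-1)}\binom{\lfloor m/2\rfloor}{n}_{q^2}.$$
   Context: The staircase board of length $m$ consists of squares $(i,j)$, $i,j\ge1$, $i+j\le m$ (row $i$ from the top, column $j$ from the left). The squares below $(i,j)$ are $(i',j)$ with $i'>i$; there are $m-i-j$. Square $(i,j)$ is shaded if $m-i-j$ is even. $\mathcal R(m,n)$ is the set of placements of $n$ rooks with no two in the same column. $\Gamma(m,n)$ is the poset on $\mathcal R(m,n)$ generated by covers $T\lessdot T'$ when $T'\in\mathcal R(m,n)$ arises from $T$ by moving one rook one square up or one square left; it is graded with rank of $T$ equal to the total number of squares below the rooks of $T$. The chain complex: $\mathcal C_i$ is free abelian with basis the rank-$i$ elements of $\Gamma(m,n)$; for $T$, let $r_1,\dots,r_s$ be the rooks of $T$ lying on unshaded squares, listed from left to right, let $T_{r}$ be the placement obtained by moving rook $r$ down one square, and set $\partial(T)=\sum_{i=1}^s(-1)^{i-1}T_{r_i}$ (extended linearly); $\partial^2=0$. The Gaussian binomial is $\binom{a}{b}_x=\frac{[a]_x!}{[b]_x![a-b]_x!}$ with $[m]_x=1+\dots+x^{m-1}$ (and $0$ if $b>a$),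 here with $x=q^2$. -}

module Defs where

open import Data.Nat as ℕ using (ℕ; zero; suc; _+_; _*_; _∸_; _≤_; _<_; _≡ᵇ_)
open import Data.Nat.DivMod using (_%_)
open import Data.Nat.Properties as ℕP using ()
open import Data.Integer as ℤ using (ℤ; +_; -_)
open import Data.Bool using (Bool; true; false; if_then_else_)
open import Data.Product using (_×_; _,_; Σ; ∃; ∃-syntax; proj₁; proj₂)
open import Data.Product.Properties using (≡-dec)
open import Data.List as List using (List; []; _∷_; _++_; map; concatMap; length; allFin; lookup)
open import Data.Nat.ListAction using (sum)
open import Data.List.Properties as ListP using ()
open import Data.List.Relation.Unary.All using (All)
open import Data.List.Relation.Binary.Pointwise using ()
open import Data.List.Relation.Unary.Linked using (Linked)
open import Data.Fin using (Fin)
open import Relation.Binary.PropositionalEquality using (_≡_)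
open import Relation.Nullary using (Dec; yes; no)

-- A square (i , j): row i (from the top), column j (from the left).
Square : Set
Square = ℕ × ℕ

row col : Square → ℕ
row = proj₁
col = proj₂

-- number of squares below (i , j) on the staircase board of length m
below : ℕ → Square → ℕ
below m (i , j) = m ∸ (i + j)

OnBoard : ℕ → Square → Set
OnBoard m (i , j) = (1 ≤ i) × (1 ≤ j) × (i + j ≤ m)

Shaded : ℕ → Square → Set
Shaded m s = below m s % 2 ≡ 0

unshaded? : ℕ → Square → Bool
unshaded? m s = below m s % 2 ≡ᵇ 1

-- A rook placement is represented canonically as the list of its rooks,
-- sorted by strictly increasing column (so no two rooks share a column).
Placement : Set
Placement = List Square

_≟P_ : (S T : Placement) → Dec (S ≡ T)
_≟P_ = ListP.≡-dec (≡-dec ℕ._≟_ ℕ._≟_)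

Valid : ℕ → ℕ → Placement → Set
Valid m n T = (length T ≡ n) × All (OnBoard m) T × Linked (λ s t → col s < col t) T

rank : ℕ → Placement → ℕ
rank m T = sum (map (below m) T)

Chain : Set
Chain = List (ℤ × Placement)

coeff : Chain → Placement → ℤ
coeff [] S = + 0
coeff ((c , T) ∷ z) S with T ≟P S
... | yes _ = c ℤ.+ coeff z S
... | no  _ = coeff z S

-- equality in the free abelian group
_≈_ : Chain → Chain → Set
z ≈ w = ∀ S → coeff z S ≡ coeff w S

scale : ℤ → Chain → Chain
scale a = map (λ { (c , T) → (a ℤ.* c , T) })

IsChain : ℕ → ℕ → ℕ → Chain → Set
IsChain m n i z = All (λ p → Valid m n (proj₂ p) × (rank m (proj₂ p) ≡ i)) z

down : Square → Square
down (i , j) = (suc i , j)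

-- ∂ on a single placement: Σ_k (-1)^(k-1) T_{r_k}, r_1,…,r_s the rooks
-- on unshaded squares from left to right.
∂₁ : ℕ → Placement → Chain
∂₁ m [] = []
∂₁ m (s ∷ T) with unshaded? m s
... | true  = (+ 1 , down s ∷ T) ∷ map (λ { (c , R) → (- c , s ∷ R) }) (∂₁ m T)
... | false = map (λ { (c , R) → (c , s ∷ R) }) (∂₁ m T)

∂ : ℕ → Chain → Chain
∂ m = concatMap (λ { (c , T) → scale c (∂₁ m T) })

lincomb : {r : ℕ} → (Fin r → ℤ) → (Fin r → Chain) → Chain
lincomb {r} c b = concatMap (λ k → scale (c k) (b k)) (allFin r)

-- the homology classes of b_0,…,b_{r-1} form a basis of
-- H_i(C,∂;ℤ) = ker(∂ : C_i → C_{i-1}) / im(∂ : C_{i+1} → C_i)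
IsHomologyBasis : (m n i : ℕ) {r : ℕ} → (Fin r → Chain) → Set
IsHomologyBasis m n i {r} b =
  (∀ k → IsChain m n i (b k) × (∂ m (b k) ≈ []))
  × (∀ z → IsChain m n i z → ∂ m z ≈ [] →
       ∃[ c ] ∃[ w ] (IsChain m n (suc i) w × (z ≈ (lincomb c b ++ ∂ m w))))
  × (∀ (c : Fin r → ℤ) w → IsChain m n (suc i) w → lincomb c b ≈ ∂ m w →
       ∀ k → c k ≡ + 0)

-- H_i has rank (dimension) d: it is free with a basis of d classes
HasDim : (m n i d : ℕ) → Set
HasDim m n i d = Σ (Fin d → Chain) (IsHomologyBasis m n i)

Special : ℕ → ℕ → ℕ → Placement → Set
Special m n i T = Valid m n T × (rank m T ≡ i) × All (λ s → (row s ≡ 1) × Shaded m s) T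

-- Polynomials with ℕ coefficients (coefficient lists, constant term first)

Poly : Set
Poly = List ℕ

pcoeff : Poly → ℕ → ℕ
pcoeff [] k = 0
pcoeff (a ∷ p) zero = a
pcoeff (a ∷ p) (suc k) = pcoeff p k

padd : Poly → Poly → Poly
padd [] q = q
padd p [] = p
padd (a ∷ p) (b ∷ q) = (a + b) ∷ padd p q

pmul : Poly → Poly → Poly
pmul [] q = []
pmul (a ∷ p) q = padd (map (a *_) q) (0 ∷ pmul p q)

pshift : ℕ → Poly → Poly
pshift zero p = p
pshift (suc s) p = 0 ∷ pshift s p

-- substitution x = q²
psq : Poly → Poly
psq [] = []
psq (a ∷ p) = a ∷ 0 ∷ psq p

qint : ℕ → Poly
qint zero = []
qint (suc a) = 1 ∷ qint a

qfact : ℕ → Poly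
qfact zero = 1 ∷ []
qfact (suc a) = pmul (qfact a) (qint (suc a))

-- coefficient of q^i in (Σ_t d t q^t) · p   (power series times polynomial)
conv : (ℕ → ℕ) → Poly → ℕ → ℕ
conv d p i = sum (map (λ t → d t * pcoeff p (i ∸ t)) (List.upTo (suc i)))

-- The quotient is expressed by clearing the denominator:
-- F = N / D  ⇔  F · D = N  (D has constant term 1, so this determines F).
SeriesIsQBinom : (ℕ → ℕ) → (s a b : ℕ) → Set
SeriesIsQBinom d s a b =
  (b ≤ a → ∀ i → conv d (psq (pmul (qfact b) (qfact (a ∸ b)))) i
                   ≡ pcoeff (pshift s (psq (qfact a))) i)
  × (a < b → ∀ i → d i ≡ 0)

module Submission where

-- After the algebra of chains and linear
-- extensions, we build a contracting homotopy h (look at the leftmost rook: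
-- if unshaded give 0, if shaded in row 1 keep it and recurse, if shaded lower
-- move it up) with ∂h + h∂ + π = id, π the projection onto special placements.
-- Special placements are cycles and never occur in boundaries, so they form a
-- basis; all bases have the same size since surplus integer vectors are
-- linearly dependent (LinearAlgebra, RankInvariance).
--
-- Special placements are the subsets
-- of the K = ⌊m/2⌋ shaded squares of row 1, so dim H_i is the coefficient of q^i
-- in their generating polynomial G K n; a q-Pascal recursion gives
-- G k n · [n]! [k-n]! = q^(n(n-1)) [k]! in x = q², the cleared q-binomial formula.

open import Defs
open import Data.Nat as ℕ using (ℕ; zero; suc)
open import Data.Product using (_×_; _,_; proj₁; proj₂; ∃-syntax)
open import Data.List as List using (List; []; _∷_; _++_; map; length)
import Data.List.Properties as ListP
open import Data.List.Relation.Unary.All as All using (All; []; _∷_)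
open import Data.List.Membership.Propositional using (_∈_; _∉_)
open import Data.List.Relation.Unary.Unique.Propositional using (Unique)
open import Relation.Binary.PropositionalEquality
open import Relation.Nullary using (Dec; yes; no; ¬_)
open import Data.Empty using (⊥; ⊥-elim)
open import Function using (_∘_)
open import Function.Bundles using (_⇔_; mk⇔)
import Function.Bundles

-- Chains as elements of the free abelian group on placements: every
-- statement about chains is a statement about their coefficients.
module Chains where

  open import Data.Integer using (ℤ; +_; -_; _+_; _*_)
  import Data.Integer.Properties as ℤP
  open import Data.Integer.Tactic.RingSolver using (solve-∀)
  open import Relation.Binary.Bundles using (Setoid)
  import Data.Nat.Properties as ℕP

  coeff-hit : ∀ c T z → coeff ((c , T) ∷ z) T ≡ c + coeff z T
  coeff-hit c T z with T ≟P T
  ... | yes _ = refl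
  ... | no T≢T = ⊥-elim (T≢T refl)

  coeff-miss : ∀ c T z S → T ≢ S → coeff ((c , T) ∷ z) S ≡ coeff z S
  coeff-miss c T z S T≢S with T ≟P S
  ... | yes T≡S = ⊥-elim (T≢S T≡S)
  ... | no _ = refl

  coeff-++ : ∀ z w S → coeff (z ++ w) S ≡ coeff z S + coeff w S
  coeff-++ [] w S = sym (ℤP.+-identityˡ _)
  coeff-++ ((c , T) ∷ z) w S with T ≟P S
  ... | yes _ = trans (cong (_+_ c) (coeff-++ z w S)) (sym (ℤP.+-assoc c _ _))
  ... | no _ = coeff-++ z w S

  coeff-scale : ∀ a z S → coeff (scale a z) S ≡ a * coeff z S
  coeff-scale a [] S = sym (ℤP.*-zeroʳ a)
  coeff-scale a ((c , T) ∷ z) S with T ≟P S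
  ... | yes _ = trans (cong (_+_ (a * c)) (coeff-scale a z S)) (sym (ℤP.*-distribˡ-+ a c _))
  ... | no _ = coeff-scale a z S

  neg : Chain → Chain
  neg = map (λ (c , T) → (- c , T))

  coeff-neg : ∀ z S → coeff (neg z) S ≡ - coeff z S
  coeff-neg [] S = refl
  coeff-neg ((c , T) ∷ z) S with T ≟P S
  ... | yes _ = trans (cong (_+_ (- c)) (coeff-neg z S)) (sym (ℤP.neg-distrib-+ c _))
  ... | no _ = coeff-neg z S

  ≈-setoid : Setoid _ _
  ≈-setoid = record
    { Carrier = Chain ; _≈_ = _≈_
    ; isEquivalence = record
      { refl = λ _ → refl ; sym = λ p S → sym (p S) ; trans = λ p q S → trans (p S) (q S) } }

  open Setoid ≈-setoid public using () renaming (trans to ≈-trans)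

  ++-cong : ∀ {z z′ w w′} → z ≈ z′ → w ≈ w′ → (z ++ w) ≈ (z′ ++ w′)
  ++-cong {z} {z′} {w} {w′} p q S = begin
    coeff (z ++ w) S            ≡⟨ coeff-++ z w S ⟩
    coeff z S + coeff w S       ≡⟨ cong₂ _+_ (p S) (q S) ⟩
    coeff z′ S + coeff w′ S     ≡⟨ coeff-++ z′ w′ S ⟨
    coeff (z′ ++ w′) S          ∎
    where open ≡-Reasoning

  scale-cong : ∀ a {z w} → z ≈ w → scale a z ≈ scale a w
  scale-cong a {z} {w} p S =
    trans (coeff-scale a z S) (trans (cong (a *_) (p S)) (sym (coeff-scale a w S)))

  neg-inverse : ∀ z → (neg z ++ z) ≈ []
  neg-inverse z S =
    trans (coeff-++ (neg z) z S)
          (trans (cong (_+ coeff z S) (coeff-neg z S)) (ℤP.+-inverseˡ (coeff z S)))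

  ++-comm : ∀ z w → (z ++ w) ≈ (w ++ z)
  ++-comm z w S = trans (coeff-++ z w S) (trans (ℤP.+-comm (coeff z S) (coeff w S)) (sym (coeff-++ w z S)))

  ++-identityʳ : ∀ z → (z ++ []) ≈ z
  ++-identityʳ z S = cong (λ u → coeff u S) (ListP.++-identityʳ z)

  scale-one : ∀ z → scale (+ 1) z ≈ z
  scale-one z S = trans (coeff-scale (+ 1) z S) (ℤP.*-identityˡ (coeff z S))

  lin : (Placement → Chain) → Chain → Chain
  lin F [] = []
  lin F ((c , T) ∷ z) = scale c (F T) ++ lin F z

  ∂≡lin : ∀ m z → ∂ m z ≡ lin (∂₁ m) z
  ∂≡lin m [] = refl
  ∂≡lin m ((c , T) ∷ z) = cong (scale c (∂₁ m T) ++_) (∂≡lin m z)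

  coeff-lin-∷ : ∀ F c T z S → coeff (lin F ((c , T) ∷ z)) S ≡ c * coeff (F T) S + coeff (lin F z) S
  coeff-lin-∷ F c T z S =
    trans (coeff-++ (scale c (F T)) (lin F z) S) (cong (_+ coeff (lin F z) S) (coeff-scale c (F T) S))

  lin-++ : ∀ F z w → lin F (z ++ w) ≡ lin F z ++ lin F w
  lin-++ F [] w = refl
  lin-++ F ((c , T) ∷ z) w =
    trans (cong (scale c (F T) ++_) (lin-++ F z w)) (sym (ListP.++-assoc (scale c (F T)) _ _))

  without : Placement → Chain → Chain
  without T [] = []
  without T ((c , R) ∷ z) with R ≟P T
  ... | yes _ = without T z
  ... | no _ = (c , R) ∷ without T z

  length-without : ∀ T z → length (without T z) ℕ.≤ length z
  length-without T [] = ℕ.z≤n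
  length-without T ((c , R) ∷ z) with R ≟P T
  ... | yes _ = ℕP.m≤n⇒m≤1+n (length-without T z)
  ... | no _ = ℕ.s≤s (length-without T z)

  coeff-without-self : ∀ T z → coeff (without T z) T ≡ + 0
  coeff-without-self T [] = refl
  coeff-without-self T ((c , R) ∷ z) with R ≟P T
  ... | yes _ = coeff-without-self T z
  ... | no R≢T = trans (coeff-miss c R (without T z) T R≢T) (coeff-without-self T z)

  coeff-without-other : ∀ T z S → S ≢ T → coeff (without T z) S ≡ coeff z S
  coeff-without-other T [] S S≢T = refl
  coeff-without-other T ((c , R) ∷ z) S S≢T with R ≟P T
  ... | yes refl = trans (coeff-without-other R z S S≢T) (sym (coeff-miss c R z S (λ R≡S → S≢T (sym R≡S))))
  ... | no _ with R ≟P S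
  ...   | yes _ = cong (_+_ c) (coeff-without-other T z S S≢T)
  ...   | no _ = coeff-without-other T z S S≢T

  lin-collect : ∀ F T z S →
    coeff (lin F z) S ≡ coeff z T * coeff (F T) S + coeff (lin F (without T z)) S
  lin-collect F T [] S = sym (ℤP.*-zeroˡ (coeff (F T) S))
  lin-collect F T ((c , R) ∷ z) S with R ≟P T
  ... | yes refl = begin
    coeff (lin F ((c , R) ∷ z)) S                                ≡⟨ coeff-lin-∷ F c R z S ⟩
    c * x + coeff (lin F z) S                                    ≡⟨ cong (_+_ (c * x)) (lin-collect F R z S) ⟩
    c * x + (coeff z R * x + coeff (lin F (without R z)) S)      ≡⟨ lemma c (coeff z R) x _ ⟩
    (c + coeff z R) * x + coeff (lin F (without R z)) S          ∎
    where
    open ≡-Reasoning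
    x : ℤ
    x = coeff (F R) S
    lemma : ∀ c a x y → c * x + (a * x + y) ≡ (c + a) * x + y
    lemma = solve-∀
  ... | no R≢T = begin
    coeff (lin F ((c , R) ∷ z)) S                                         ≡⟨ coeff-lin-∷ F c R z S ⟩
    c * x + coeff (lin F z) S                                             ≡⟨ cong (_+_ (c * x)) (lin-collect F T z S) ⟩
    c * x + (coeff z T * y + coeff (lin F (without T z)) S)               ≡⟨ lemma (c * x) (coeff z T * y) _ ⟩
    coeff z T * y + (c * x + coeff (lin F (without T z)) S)               ≡⟨ cong (_+_ (coeff z T * y)) (coeff-lin-∷ F c R (without T z) S) ⟨
    coeff z T * y + coeff (lin F ((c , R) ∷ without T z)) S              ∎
    where
    open ≡-Reasoning
    x y : ℤ
    x = coeff (F R) S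
    y = coeff (F T) S
    lemma : ∀ a b r → a + (b + r) ≡ b + (a + r)
    lemma = solve-∀

  without-head : ∀ c T z → without T ((c , T) ∷ z) ≡ without T z
  without-head c T z with T ≟P T
  ... | yes _ = refl
  ... | no T≢T = ⊥-elim (T≢T refl)

  -- Linear extensions are well defined on the free abelian group: they
  -- send the zero chain to zero (by induction on the number of terms).
  lin-null : ∀ F z → z ≈ [] → lin F z ≈ []
  lin-null F z = go (length z) z ℕP.≤-refl
    where
    go : ∀ n z → length z ℕ.≤ n → z ≈ [] → lin F z ≈ []
    go n [] _ _ S = refl
    go (suc n) ((c , T) ∷ z) (ℕ.s≤s len≤n) z≈0 S = begin
      coeff (lin F ((c , T) ∷ z)) S                                  ≡⟨ lin-collect F T ((c , T) ∷ z) S ⟩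
      coeff ((c , T) ∷ z) T * x + coeff (lin F (without T ((c , T) ∷ z))) S
                                                                       ≡⟨ cong₂ (λ a w → a * x + coeff (lin F w) S) (z≈0 T) (without-head c T z) ⟩
      + 0 * x + coeff (lin F (without T z)) S                        ≡⟨ cong (_+_ (+ 0 * x)) (rest S) ⟩
      + 0 * x + + 0                                                  ≡⟨ cong (_+ + 0) (ℤP.*-zeroˡ x) ⟩
      + 0                                                            ∎
      where
      open ≡-Reasoning
      x : ℤ
      x = coeff (F T) S
      rest-null : without T z ≈ []
      rest-null S′ with S′ ≟P T
      ... | yes refl = coeff-without-self S′ z
      ... | no S′≢T = begin
        coeff (without T z) S′      ≡⟨ coeff-without-other T z S′ S′≢T ⟩
        coeff z S′                  ≡⟨ coeff-miss c T z S′ (λ T≡S′ → S′≢T (sym T≡S′)) ⟨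
        coeff ((c , T) ∷ z) S′      ≡⟨ z≈0 S′ ⟩
        + 0                         ∎
      rest : lin F (without T z) ≈ []
      rest = go n (without T z) (ℕP.≤-trans (length-without T z) len≤n) rest-null

  lin-scale : ∀ F a z → lin F (scale a z) ≈ scale a (lin F z)
  lin-scale F a [] S = refl
  lin-scale F a ((c , T) ∷ z) S = begin
    coeff (lin F ((a * c , T) ∷ scale a z)) S          ≡⟨ coeff-lin-∷ F (a * c) T (scale a z) S ⟩
    a * c * x + coeff (lin F (scale a z)) S            ≡⟨ cong (_+_ (a * c * x)) (trans (lin-scale F a z S) (coeff-scale a (lin F z) S)) ⟩
    a * c * x + a * coeff (lin F z) S                  ≡⟨ lemma a c x (coeff (lin F z) S) ⟩
    a * (c * x + coeff (lin F z) S)                    ≡⟨ cong (a *_) (coeff-lin-∷ F c T z S) ⟨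
    a * coeff (lin F ((c , T) ∷ z)) S                  ≡⟨ coeff-scale a (lin F ((c , T) ∷ z)) S ⟨
    coeff (scale a (lin F ((c , T) ∷ z))) S            ∎
    where
    open ≡-Reasoning
    x : ℤ
    x = coeff (F T) S
    lemma : ∀ a c x y → a * c * x + a * y ≡ a * (c * x + y)
    lemma = solve-∀

  lin-∘ : ∀ F G z → lin F (lin G z) ≈ lin (λ T → lin F (G T)) z
  lin-∘ F G [] S = refl
  lin-∘ F G ((c , T) ∷ z) S = begin
    coeff (lin F (scale c (G T) ++ lin G z)) S                   ≡⟨ cong (λ u → coeff u S) (lin-++ F (scale c (G T)) (lin G z)) ⟩
    coeff (lin F (scale c (G T)) ++ lin F (lin G z)) S
      ≡⟨ ++-cong {lin F (scale c (G T))} {scale c (lin F (G T))} {lin F (lin G z)} (lin-scale F c (G T)) (lin-∘ F G z) S ⟩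
    coeff (scale c (lin F (G T)) ++ lin (λ T → lin F (G T)) z) S ∎
    where open ≡-Reasoning

  lin-+ : ∀ F G z → (lin F z ++ lin G z) ≈ lin (λ T → F T ++ G T) z
  lin-+ F G [] S = refl
  lin-+ F G ((c , T) ∷ z) S = begin
    coeff (lin F ((c , T) ∷ z) ++ lin G ((c , T) ∷ z)) S            ≡⟨ coeff-++ (lin F ((c , T) ∷ z)) _ S ⟩
    coeff (lin F ((c , T) ∷ z)) S + coeff (lin G ((c , T) ∷ z)) S    ≡⟨ cong₂ _+_ (coeff-lin-∷ F c T z S) (coeff-lin-∷ G c T z S) ⟩
    (c * f + coeff (lin F z) S) + (c * g + coeff (lin G z) S)        ≡⟨ lemma c f g (coeff (lin F z) S) (coeff (lin G z) S) ⟩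
    c * (f + g) + (coeff (lin F z) S + coeff (lin G z) S)            ≡⟨ cong₂ (λ a b → c * a + b) (coeff-++ (F T) (G T) S) (coeff-++ (lin F z) (lin G z) S) ⟨
    c * coeff (F T ++ G T) S + coeff (lin F z ++ lin G z) S          ≡⟨ cong (_+_ (c * coeff (F T ++ G T) S)) (lin-+ F G z S) ⟩
    c * coeff (F T ++ G T) S + coeff (lin (λ T → F T ++ G T) z) S    ≡⟨ coeff-lin-∷ (λ T → F T ++ G T) c T z S ⟨
    coeff (lin (λ T → F T ++ G T) ((c , T) ∷ z)) S                  ∎
    where
    open ≡-Reasoning
    f g : ℤ
    f = coeff (F T) S
    g = coeff (G T) S
    lemma : ∀ c f g x y → (c * f + x) + (c * g + y) ≡ c * (f + g) + (x + y)
    lemma = solve-∀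

  unit : Placement → Chain
  unit T = (+ 1 , T) ∷ []

  lin-unit : ∀ z → lin unit z ≈ z
  lin-unit [] S = refl
  lin-unit ((c , T) ∷ z) S with T ≟P S
  ... | yes _ = cong₂ _+_ (ℤP.*-identityʳ c) (lin-unit z S)
  ... | no _ = lin-unit z S

  lin-nil : ∀ z → lin (λ _ → []) z ≡ []
  lin-nil [] = refl
  lin-nil ((c , T) ∷ z) = lin-nil z

  Supported : (Placement → Set) → Chain → Set
  Supported P = All (λ (_ , T) → P T)

  Supported-++ : ∀ {P z w} → Supported P z → Supported P w → Supported P (z ++ w)
  Supported-++ [] q = q
  Supported-++ (x ∷ p) q = x ∷ Supported-++ p q

  Supported-scale : ∀ {P} a {z} → Supported P z → Supported P (scale a z)
  Supported-scale a [] = []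
  Supported-scale a (x ∷ p) = x ∷ Supported-scale a p

  Supported-lin : ∀ {P Q} F {z} → (∀ T → P T → Supported Q (F T)) → Supported P z → Supported Q (lin F z)
  Supported-lin F f [] = []
  Supported-lin F {(c , T) ∷ z} f (x ∷ p) = Supported-++ (Supported-scale c (f T x)) (Supported-lin F f p)

  coeff-unsupported : ∀ {P} z S → Supported P z → ¬ P S → coeff z S ≡ + 0
  coeff-unsupported [] S _ _ = refl
  coeff-unsupported ((c , T) ∷ z) S (x ∷ p) ¬PS with T ≟P S
  ... | yes refl = ⊥-elim (¬PS x)
  ... | no _ = coeff-unsupported z S p ¬PS

  lin-local : ∀ {P} F G {z} → Supported P z → (∀ T → P T → F T ≈ G T) → lin F z ≈ lin G z
  lin-local F G [] F≈G S = refl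
  lin-local F G {(c , T) ∷ z} (x ∷ p) F≈G =
    ++-cong {scale c (F T)} {scale c (G T)} {lin F z} {lin G z}
            (scale-cong c {F T} {G T} (F≈G T x)) (lin-local F G p F≈G)

  lin-at : ∀ F G z S → (∀ T → coeff (F T) S ≡ coeff (G T) S) → coeff (lin F z) S ≡ coeff (lin G z) S
  lin-at F G [] S F≡G = refl
  lin-at F G ((c , T) ∷ z) S F≡G =
    trans (coeff-lin-∷ F c T z S)
          (trans (cong₂ (λ x y → c * x + y) (F≡G T) (lin-at F G z S F≡G)) (sym (coeff-lin-∷ G c T z S)))

  prepend : Square → Chain → Chain
  prepend s = map (λ (c , R) → (c , s ∷ R))

  _≟S_ : (s t : Square) → Dec (s ≡ t)
  _≟S_ = DP.≡-dec ℕ._≟_ ℕ._≟_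
    where import Data.Product.Properties as DP

  coeff-prepend-hit : ∀ s X R → coeff (prepend s X) (s ∷ R) ≡ coeff X R
  coeff-prepend-hit s [] R = refl
  coeff-prepend-hit s ((c , T) ∷ X) R = by-cases (T ≟P R)
    where
    by-cases : Dec (T ≡ R) → coeff ((c , s ∷ T) ∷ prepend s X) (s ∷ R) ≡ coeff ((c , T) ∷ X) R
    by-cases (yes refl) = begin
      coeff ((c , s ∷ T) ∷ prepend s X) (s ∷ T)   ≡⟨ coeff-hit c (s ∷ T) (prepend s X) ⟩
      c + coeff (prepend s X) (s ∷ T)             ≡⟨ cong (_+_ c) (coeff-prepend-hit s X T) ⟩
      c + coeff X T                               ≡⟨ coeff-hit c T X ⟨
      coeff ((c , T) ∷ X) T                       ∎
      where open ≡-Reasoning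
    by-cases (no T≢R) = begin
      coeff ((c , s ∷ T) ∷ prepend s X) (s ∷ R)   ≡⟨ coeff-miss c (s ∷ T) (prepend s X) (s ∷ R) (T≢R ∘ ListP.∷-injectiveʳ) ⟩
      coeff (prepend s X) (s ∷ R)                 ≡⟨ coeff-prepend-hit s X R ⟩
      coeff X R                                   ≡⟨ coeff-miss c T X R T≢R ⟨
      coeff ((c , T) ∷ X) R                       ∎
      where open ≡-Reasoning

  coeff-prepend-miss : ∀ s X S → (∀ R → S ≢ s ∷ R) → coeff (prepend s X) S ≡ + 0
  coeff-prepend-miss s [] S S≢s∷ = refl
  coeff-prepend-miss s ((c , T) ∷ X) S S≢s∷ =
    trans (coeff-miss c (s ∷ T) (prepend s X) S (λ e → S≢s∷ T (sym e))) (coeff-prepend-miss s X S S≢s∷)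

  prepend-cong : ∀ s {X Y} → X ≈ Y → prepend s X ≈ prepend s Y
  prepend-cong s {X} {Y} X≈Y [] =
    trans (coeff-prepend-miss s X [] (λ R ())) (sym (coeff-prepend-miss s Y [] (λ R ())))
  prepend-cong s {X} {Y} X≈Y (t ∷ R) with t ≟S s
  ... | yes refl = trans (coeff-prepend-hit s X R) (trans (X≈Y R) (sym (coeff-prepend-hit s Y R)))
  ... | no t≢s = trans (coeff-prepend-miss s X (t ∷ R) miss) (sym (coeff-prepend-miss s Y (t ∷ R) miss))
    where
    miss : ∀ R′ → t ∷ R ≢ s ∷ R′
    miss R′ = t≢s ∘ ListP.∷-injectiveˡ

  prepend-++ : ∀ s X Y → prepend s (X ++ Y) ≡ prepend s X ++ prepend s Y
  prepend-++ s X Y = ListP.map-++ _ X Y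

  prepend-scale : ∀ s a X → scale a (prepend s X) ≡ prepend s (scale a X)
  prepend-scale s a [] = refl
  prepend-scale s a ((c , R) ∷ X) = cong (_ ∷_) (prepend-scale s a X)

  lin-prepend : ∀ s t F G → (∀ R → F (s ∷ R) ≡ prepend t (G R)) →
    ∀ X → lin F (prepend s X) ≡ prepend t (lin G X)
  lin-prepend s t F G F∘s≡ [] = refl
  lin-prepend s t F G F∘s≡ ((c , R) ∷ X) = begin
    scale c (F (s ∷ R)) ++ lin F (prepend s X)           ≡⟨ cong₂ _++_ (cong (scale c) (F∘s≡ R)) (lin-prepend s t F G F∘s≡ X) ⟩
    scale c (prepend t (G R)) ++ prepend t (lin G X)     ≡⟨ cong (_++ prepend t (lin G X)) (prepend-scale t c (G R)) ⟩
    prepend t (scale c (G R)) ++ prepend t (lin G X)     ≡⟨ prepend-++ t (scale c (G R)) (lin G X) ⟨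
    prepend t (scale c (G R) ++ lin G X)                 ∎
    where open ≡-Reasoning

module Homotopy (m : ℕ) where

  open Chains
  open import Data.Nat using (_≡ᵇ_; _∸_; _+_; _≤_; s≤s)
  open import Data.Nat.DivMod using (_%_)
  import Data.Nat.Properties as ℕP
  open import Data.Bool using (Bool; true; false; not)
  open import Data.Integer using (+_)
  open import Relation.Nullary using (contradiction)
  open import Relation.Nullary.Decidable using (_×-dec_)
  import Relation.Binary.Reasoning.Setoid as SetoidReasoning

  -- Parity of squares.  A square is unshaded iff the number of squares
  -- below it is odd; moving one square up or down changes this number by 1.
  odd? : ℕ → Bool
  odd? b = b % 2 ≡ᵇ 1

  odd?-suc : ∀ b → odd? (suc b) ≡ not (odd? b)
  odd?-suc zero = refl
  odd?-suc (suc zero) = refl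
  odd?-suc (suc (suc b)) = odd?-suc b

  shaded⇒¬unshaded : ∀ s → Shaded m s → unshaded? m s ≡ false
  shaded⇒¬unshaded s even rewrite even = refl

  ¬unshaded⇒shaded : ∀ s → unshaded? m s ≡ false → Shaded m s
  ¬unshaded⇒shaded s = go (below m s)
    where
    go : ∀ b → odd? b ≡ false → b % 2 ≡ 0
    go zero _ = refl
    go (suc zero) ()
    go (suc (suc b)) = go b

  up : Square → Square
  up (i , j) = (ℕ.pred i , j)

  below-down : ∀ s → below m (down s) ≡ ℕ.pred (below m s)
  below-down (i , j) = sym (ℕP.pred[m∸n]≡m∸[1+n] m (i + j))

  below-up : ∀ i j → suc i + j ≤ m → below m (i , j) ≡ suc (below m (suc i , j))
  below-up i j = go m (i + j)
    where
    go : ∀ a n → suc n ≤ a → a ∸ n ≡ suc (a ∸ suc n)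
    go (suc a) zero _ = refl
    go (suc a) (suc n) (s≤s n<a) = go a n n<a

  down-unshaded : ∀ s → unshaded? m s ≡ true → unshaded? m (down s) ≡ false
  down-unshaded s odd rewrite below-down s = go (below m s) odd
    where
    go : ∀ b → odd? b ≡ true → odd? (ℕ.pred b) ≡ false
    go (suc b) odd rewrite odd?-suc b with odd? b
    ... | false = refl

  up-shaded : ∀ i j → suc i + j ≤ m → unshaded? m (suc i , j) ≡ false → unshaded? m (i , j) ≡ true
  up-shaded i j onBoard even rewrite below-up i j onBoard | odd?-suc (below m (suc i , j)) | even = refl

  -- The kinds of leftmost rooks that the homotopy distinguishes (row 0 is
  -- off the board).
  data Kind : Square → Set where
    unshaded : ∀ {s} → unshaded? m s ≡ true → Kind s
    top      : ∀ {j} → unshaded? m (1 , j) ≡ false → Kind (1 , j)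
    low      : ∀ {i j} → unshaded? m (suc (suc i) , j) ≡ false → Kind (suc (suc i) , j)
    offBoard : ∀ {j} → Kind (0 , j)

  kind : ∀ s → Kind s
  kind s with unshaded? m s in eq
  kind s                  | true = unshaded eq
  kind (zero , j)         | false = offBoard
  kind (suc zero , j)     | false = top eq
  kind (suc (suc i) , j)  | false = low eq

  h₁ : Placement → Chain
  h₁ [] = []
  h₁ (s ∷ T) with kind s
  ... | unshaded _ = []
  ... | top _ = prepend s (h₁ T)
  ... | low _ = unit (up s ∷ T)
  ... | offBoard = []

  TopShaded : Square → Set
  TopShaded s = (row s ≡ 1) × Shaded m s

  AllTopShaded : Placement → Set
  AllTopShaded = All TopShaded

  topShaded? : ∀ s → Dec (TopShaded s)
  topShaded? s = (row s ℕ.≟ 1) ×-dec (below m s % 2 ℕ.≟ 0)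

  keepIf : (T : Placement) → Dec (AllTopShaded T) → Chain
  keepIf T (yes _) = unit T
  keepIf T (no _) = []

  π₁ : Placement → Chain
  π₁ T = keepIf T (All.all? topShaded? T)

  π₁-special : ∀ {T} → AllTopShaded T → π₁ T ≡ unit T
  π₁-special {T} special with All.all? topShaded? T
  ... | yes _ = refl
  ... | no ¬special = contradiction special ¬special

  π₁-nonspecial : ∀ {T} → ¬ AllTopShaded T → π₁ T ≡ []
  π₁-nonspecial {T} ¬special with All.all? topShaded? T
  ... | yes special = contradiction special ¬special
  ... | no _ = refl

  ∂′ h π : Chain → Chain
  ∂′ = lin (∂₁ m)
  h = lin h₁
  π = lin π₁

  h₁-unshaded : ∀ s R → unshaded? m s ≡ true → h₁ (s ∷ R) ≡ []
  h₁-unshaded s R odd with kind s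
  ... | unshaded _ = refl
  ... | top even = contradiction (trans (sym odd) even) λ ()
  ... | low even = contradiction (trans (sym odd) even) λ ()
  ... | offBoard = refl

  h₁-top : ∀ j R → unshaded? m (1 , j) ≡ false → h₁ ((1 , j) ∷ R) ≡ prepend (1 , j) (h₁ R)
  h₁-top j R even with kind (1 , j)
  ... | unshaded odd = contradiction (trans (sym odd) even) λ ()
  ... | top _ = refl

  h₁-low : ∀ i j R → unshaded? m (suc (suc i) , j) ≡ false →
    h₁ ((suc (suc i) , j) ∷ R) ≡ unit ((suc i , j) ∷ R)
  h₁-low i j R even with kind (suc (suc i) , j)
  ... | unshaded odd = contradiction (trans (sym odd) even) λ ()
  ... | low _ = refl

  ∂₁-shaded : ∀ s T → unshaded? m s ≡ false → ∂₁ m (s ∷ T) ≡ prepend s (∂₁ m T)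
  ∂₁-shaded s T even rewrite even = ListP.map-cong (λ _ → refl) (∂₁ m T)

  ∂₁-unshaded : ∀ s T → unshaded? m s ≡ true →
    ∂₁ m (s ∷ T) ≡ (+ 1 , down s ∷ T) ∷ prepend s (neg (∂₁ m T))
  ∂₁-unshaded s T odd rewrite odd =
    cong (_ ∷_) (trans (ListP.map-cong (λ _ → refl) (∂₁ m T)) (ListP.map-∘ (∂₁ m T)))

  π₁-top : ∀ s T → TopShaded s → π₁ (s ∷ T) ≡ prepend s (π₁ T)
  π₁-top s T ts = by-cases (All.all? topShaded? T)
    where
    by-cases : Dec (AllTopShaded T) → π₁ (s ∷ T) ≡ prepend s (π₁ T)
    by-cases (yes special) =
      trans (π₁-special (ts ∷ special)) (cong (prepend s) (sym (π₁-special special)))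
    by-cases (no ¬special) =
      trans (π₁-nonspecial λ { (_ ∷ special) → ¬special special }) (cong (prepend s) (sym (π₁-nonspecial ¬special)))

  π₁-notTop : ∀ s T → ¬ TopShaded s → π₁ (s ∷ T) ≡ []
  π₁-notTop s T ¬ts = π₁-nonspecial λ { (ts ∷ _) → ¬ts ts }

  cong₃ : ∀ {A B C D : Set} (f : A → B → C → D) {a a′ b b′ c c′} →
    a ≡ a′ → b ≡ b′ → c ≡ c′ → f a b c ≡ f a′ b′ c′
  cong₃ f refl refl refl = refl

  HomotopyAt : Placement → Set
  HomotopyAt T = (∂′ (h₁ T) ++ (h (∂₁ m T) ++ π₁ T)) ≈ unit T

  open SetoidReasoning ≈-setoid

  -- A shaded rook in row 1 is carried along.
  homotopy-top : ∀ j T → unshaded? m (1 , j) ≡ false → HomotopyAt T → HomotopyAt ((1 , j) ∷ T)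
  homotopy-top j T even hom = begin
    ∂′ (h₁ (s ∷ T)) ++ (h (∂₁ m (s ∷ T)) ++ π₁ (s ∷ T))
      ≡⟨ cong₃ (λ a b c → ∂′ a ++ (h b ++ c)) (h₁-top j T even) (∂₁-shaded s T even)
               (π₁-top s T (refl , ¬unshaded⇒shaded s even)) ⟩
    ∂′ (prepend s (h₁ T)) ++ (h (prepend s X) ++ prepend s (π₁ T))
      ≡⟨ cong₂ (λ a b → a ++ (b ++ prepend s (π₁ T)))
               (lin-prepend s s (∂₁ m) (∂₁ m) (λ R → ∂₁-shaded s R even) (h₁ T))
               (lin-prepend s s h₁ h₁ (λ R → h₁-top j R even) X) ⟩
    prepend s (∂′ (h₁ T)) ++ (prepend s (h X) ++ prepend s (π₁ T))
      ≡⟨ trans (prepend-++ s (∂′ (h₁ T)) _) (cong (prepend s (∂′ (h₁ T)) ++_) (prepend-++ s (h X) (π₁ T))) ⟨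
    prepend s (∂′ (h₁ T) ++ (h X ++ π₁ T))
      ≈⟨ prepend-cong s {∂′ (h₁ T) ++ (h X ++ π₁ T)} {unit T} hom ⟩
    unit (s ∷ T) ∎
    where
    s : Square
    s = (1 , j)
    X : Chain
    X = ∂₁ m T

  -- An unshaded rook s: ∂ moves it down, and h moves it back up.
  homotopy-unshaded : ∀ i j T → unshaded? m (suc i , j) ≡ true → HomotopyAt ((suc i , j) ∷ T)
  homotopy-unshaded i j T odd = begin
    ∂′ (h₁ (s ∷ T)) ++ (h (∂₁ m (s ∷ T)) ++ π₁ (s ∷ T))
      ≡⟨ cong₃ (λ a b c → ∂′ a ++ (h b ++ c)) (h₁-unshaded s T odd) (∂₁-unshaded s T odd)
               (π₁-notTop s T λ (_ , even) → contradiction (trans (sym odd) (shaded⇒¬unshaded s even)) λ ()) ⟩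
    (scale (+ 1) (h₁ (down s ∷ T)) ++ h (prepend s (neg X))) ++ []
      ≡⟨ cong₂ (λ a b → (scale (+ 1) a ++ b) ++ [])
               (h₁-low i j T (down-unshaded s odd))
               (trans (lin-prepend s s h₁ (λ _ → []) (λ R → h₁-unshaded s R odd) (neg X))
                      (cong (prepend s) (lin-nil (neg X)))) ⟩
    unit (s ∷ T) ∎
    where
    s : Square
    s = (suc i , j)
    X : Chain
    X = ∂₁ m T

  -- A shaded rook s below row 1: h moves it up to the unshaded square t,
  -- and ∂ moves it back down.
  homotopy-low : ∀ i j T → suc (suc i) + j ≤ m → unshaded? m (suc (suc i) , j) ≡ false →
    HomotopyAt ((suc (suc i) , j) ∷ T)
  homotopy-low i j T onBoard even = begin
    ∂′ (h₁ (s ∷ T)) ++ (h (∂₁ m (s ∷ T)) ++ π₁ (s ∷ T))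
      ≡⟨ cong₃ (λ a b c → ∂′ a ++ (h b ++ c)) (h₁-low i j T even) (∂₁-shaded s T even)
               (π₁-notTop s T λ (row≡1 , _) → contradiction row≡1 λ ()) ⟩
    (scale (+ 1) (∂₁ m (t ∷ T)) ++ []) ++ (h (prepend s X) ++ [])
      ≡⟨ cong₂ (λ a b → (scale (+ 1) a ++ []) ++ (b ++ []))
               (∂₁-unshaded t T (up-shaded (suc i) j onBoard even))
               (lin-prepend s t h₁ unit (λ R → h₁-low i j R even) X) ⟩
    (scale (+ 1) ((+ 1 , s ∷ T) ∷ prepend t (neg X)) ++ []) ++ (prepend t (lin unit X) ++ [])
      ≈⟨ ++-cong {scale (+ 1) Y ++ []} {Y} {prepend t (lin unit X) ++ []} {prepend t X} ∂-part h-part ⟩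
    ((+ 1 , s ∷ T) ∷ prepend t (neg X)) ++ prepend t X
      ≡⟨ cong ((+ 1 , s ∷ T) ∷_) (prepend-++ t (neg X) X) ⟨
    (+ 1 , s ∷ T) ∷ prepend t (neg X ++ X)
      ≈⟨ ++-cong {unit (s ∷ T)} {unit (s ∷ T)} (λ _ → refl) (prepend-cong t {neg X ++ X} {[]} (neg-inverse X)) ⟩
    unit (s ∷ T) ∎
    where
    s t : Square
    s = (suc (suc i) , j)
    t = (suc i , j)
    X Y : Chain
    X = ∂₁ m T
    Y = (+ 1 , s ∷ T) ∷ prepend t (neg X)
    ∂-part : (scale (+ 1) Y ++ []) ≈ Y
    ∂-part = ≈-trans {scale (+ 1) Y ++ []} {scale (+ 1) Y} {Y} (++-identityʳ (scale (+ 1) Y)) (scale-one Y)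
    h-part : (prepend t (lin unit X) ++ []) ≈ prepend t X
    h-part = ≈-trans {prepend t (lin unit X) ++ []} {prepend t (lin unit X)} {prepend t X}
                     (++-identityʳ (prepend t (lin unit X))) (prepend-cong t {lin unit X} {X} (lin-unit X))

  homotopy-step : ∀ {s} T → Kind s → OnBoard m s → HomotopyAt T → HomotopyAt (s ∷ T)
  homotopy-step {suc i , j} T (unshaded odd) _ _ = homotopy-unshaded i j T odd
  homotopy-step {zero , j} T (unshaded _) (() , _) _
  homotopy-step {1 , j} T (top even) _ hom = homotopy-top j T even hom
  homotopy-step {suc (suc i) , j} T (low even) (_ , _ , onBoard) _ = homotopy-low i j T onBoard even
  homotopy-step T offBoard (() , _) _

  homotopy₁ : ∀ T → All (OnBoard m) T → HomotopyAt T
  homotopy₁ [] [] S = refl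
  homotopy₁ (s ∷ T) (on ∷ ons) = homotopy-step T (kind s) on (homotopy₁ T ons)

  homotopy : ∀ z → Supported (All (OnBoard m)) z → (∂′ (h z) ++ (h (∂′ z) ++ π z)) ≈ z
  homotopy z onBoard = begin
    ∂′ (h z) ++ (h (∂′ z) ++ π z)
      ≈⟨ ++-cong {∂′ (h z)} {lin A z} (lin-∘ (∂₁ m) h₁ z)
                 (++-cong {h (∂′ z)} {lin B z} {π z} {π z} (lin-∘ h₁ (∂₁ m) z) (λ _ → refl)) ⟩
    lin A z ++ (lin B z ++ π z)
      ≈⟨ ++-cong {lin A z} {lin A z} (λ _ → refl) (lin-+ B π₁ z) ⟩
    lin A z ++ lin (λ T → B T ++ π₁ T) z
      ≈⟨ lin-+ A (λ T → B T ++ π₁ T) z ⟩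
    lin (λ T → A T ++ (B T ++ π₁ T)) z
      ≈⟨ lin-local _ unit onBoard homotopy₁ ⟩
    lin unit z
      ≈⟨ lin-unit z ⟩
    z ∎
    where
    A B : Placement → Chain
    A T = ∂′ (h₁ T)
    B T = h (∂₁ m T)

module Support (m : ℕ) where

  open Chains
  open Homotopy m
  open import Data.Nat using (_+_; _<_; s≤s; z≤n)
  import Data.Nat.Properties as ℕP
  open import Data.Integer using (+_)
  open import Data.List.Relation.Unary.All.Properties using (map⁺)
  open import Data.Bool using (true; false)
  open import Data.List.Relation.Unary.Linked using (Linked; []; [-]; _∷_)

  OneUp : Placement → Placement → Set
  OneUp T R = (map col R ≡ map col T) × (length R ≡ length T) × All (OnBoard m) R × (rank m R ≡ suc (rank m T))

  oneUp-∷ : ∀ {s T R} → OnBoard m s → OneUp T R → OneUp (s ∷ T) (s ∷ R)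
  oneUp-∷ {s} {T} {R} on (cols , len , ons , rk) =
    cong (col s ∷_) cols , cong suc len , on ∷ ons ,
    trans (cong (_+_ (below m s)) rk) (ℕP.+-suc (below m s) (rank m T))

  Supported-prepend : ∀ {P} s X → Supported (λ R → P (s ∷ R)) X → Supported P (prepend s X)
  Supported-prepend s X = map⁺

  h₁-oneUp : ∀ T → All (OnBoard m) T → Supported (OneUp T) (h₁ T)
  h₁-oneUp [] [] = []
  h₁-oneUp (s ∷ T) (on ∷ ons) = step (kind s) on
    where
    step : ∀ {s} → Kind s → OnBoard m s → Supported (OneUp (s ∷ T)) (h₁ (s ∷ T))
    step {s} (unshaded odd) _ rewrite h₁-unshaded s T odd = []
    step {1 , j} (top even) on rewrite h₁-top j T even =
      Supported-prepend (1 , j) (h₁ T) (All.map (oneUp-∷ on) (h₁-oneUp T ons))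
    step {suc (suc i) , j} (low even) (_ , 1≤j , onBoard) rewrite h₁-low i j T even =
      (refl , refl , onUp ∷ ons , cong (_+ rank m T) (below-up (suc i) j onBoard)) ∷ []
      where
      onUp : OnBoard m (suc i , j)
      onUp = s≤s z≤n , 1≤j , ℕP.≤-trans (ℕP.n≤1+n _) onBoard
    step offBoard (() , _)

  linked-cols : ∀ R T → map col R ≡ map col T → Linked (λ s t → col s < col t) T →
    Linked (λ s t → col s < col t) R
  linked-cols [] T _ _ = []
  linked-cols (r ∷ []) T _ _ = [-]
  linked-cols (r ∷ r′ ∷ R) (t ∷ t′ ∷ T) cols (t<t′ ∷ lk) with ListP.∷-injective cols
  ... | r≡t , cols′ =
    subst₂ _<_ (sym r≡t) (sym (ListP.∷-injectiveˡ cols′)) t<t′ ∷ linked-cols (r′ ∷ R) (t′ ∷ T) cols′ lk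

  h-chain : ∀ n i z → IsChain m n i z → IsChain m n (suc i) (h z)
  h-chain n i z = Supported-lin h₁ valid
    where
    valid : ∀ T → Valid m n T × rank m T ≡ i → Supported (λ R → Valid m n R × rank m R ≡ suc i) (h₁ T)
    valid T ((len , ons , lk) , rk) =
      All.map (λ {(_ , R)} (cols , len′ , ons′ , rk′) →
                 (trans len′ len , ons′ , linked-cols R T cols lk) , trans rk′ (cong suc rk))
              (h₁-oneUp T ons)

  coeff-π-special : ∀ z S → AllTopShaded S → coeff (π z) S ≡ coeff z S
  coeff-π-special z S special-S = trans (lin-at π₁ unit z S at-S) (lin-unit z S)
    where
    at-S : ∀ T → coeff (π₁ T) S ≡ coeff (unit T) S
    at-S T = by-cases (All.all? topShaded? T)
      where
      by-cases : Dec (AllTopShaded T) → coeff (π₁ T) S ≡ coeff (unit T) S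
      by-cases (yes special-T) = cong (λ u → coeff u S) (π₁-special special-T)
      by-cases (no ¬special-T) = trans (cong (λ u → coeff u S) (π₁-nonspecial ¬special-T))
                                       (sym (coeff-miss (+ 1) T [] S λ { refl → ¬special-T special-S }))

  coeff-π-nonspecial : ∀ z S → ¬ AllTopShaded S → coeff (π z) S ≡ + 0
  coeff-π-nonspecial z S ¬special-S =
    trans (lin-at π₁ (λ _ → []) z S at-S) (cong (λ u → coeff u S) (lin-nil z))
    where
    at-S : ∀ T → coeff (π₁ T) S ≡ + 0
    at-S T = by-cases (All.all? topShaded? T)
      where
      by-cases : Dec (AllTopShaded T) → coeff (π₁ T) S ≡ + 0
      by-cases (yes special-T) = trans (cong (λ u → coeff u S) (π₁-special special-T))
                                       (coeff-miss (+ 1) T [] S λ { refl → ¬special-S special-T })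
      by-cases (no ¬special-T) = cong (λ u → coeff u S) (π₁-nonspecial ¬special-T)

  ∂₁-special : ∀ T → AllTopShaded T → ∂₁ m T ≡ []
  ∂₁-special [] [] = refl
  ∂₁-special (s ∷ T) ((_ , even) ∷ special) =
    trans (∂₁-shaded s T (shaded⇒¬unshaded s even)) (cong (prepend s) (∂₁-special T special))

  tail-nonspecial : ∀ s {R} → ¬ AllTopShaded R → ¬ AllTopShaded (s ∷ R)
  tail-nonspecial s ¬special (_ ∷ special) = ¬special special

  ∂₁-nonspecial : ∀ T → All (OnBoard m) T → Supported (λ R → ¬ AllTopShaded R) (∂₁ m T)
  ∂₁-nonspecial [] [] = []
  ∂₁-nonspecial ((i , j) ∷ T) ((1≤i , _) ∷ ons) with unshaded? m (i , j)
  ... | true = down-nonspecial ∷ map⁺ (All.map (tail-nonspecial (i , j)) (∂₁-nonspecial T ons))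
    where
    -- the rook moved down from row i ≥ 1 is not in row 1
    down-nonspecial : ¬ AllTopShaded ((suc i , j) ∷ T)
    down-nonspecial ((row≡1 , _) ∷ _) = ℕP.<⇒≢ 1≤i (sym (ℕP.suc-injective row≡1))
  ... | false = map⁺ (All.map (tail-nonspecial (i , j)) (∂₁-nonspecial T ons))

module LinearAlgebra where

  open import Data.Nat using (_<_; s≤s)
  import Data.Nat.Properties as ℕP
  open import Data.Fin using (Fin; zero; suc; punchIn)
  open import Data.Fin.Properties using (any?; punchInᵢ≢i)
  open import Data.Integer using (ℤ; +_; -_; _+_; _*_; _-_)
  import Data.Integer.Properties as ℤP
  open import Data.Integer.Tactic.RingSolver using (solve-∀)
  open import Data.Product using (∃)
  open import Data.Sum using (inj₁; inj₂)
  open import Data.Vec.Functional using (insertAt)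
  open import Data.Vec.Functional.Properties using (insertAt-lookup; insertAt-punchIn)
  open import Relation.Nullary using (¬?)
  open import Relation.Nullary.Decidable using (decidable-stable)
  open import Algebra.Properties.Semiring.Sum ℤP.+-*-semiring public
    using (sum; sum-syntax; sum-cong-≗; sum-replicate-zero; sum-remove; ∑-distrib-+; ∑-comm; *-distribˡ-sum; *-distribʳ-sum)

  sum-zero : ∀ {n} (t : Fin n → ℤ) → (∀ k → t k ≡ + 0) → sum t ≡ + 0
  sum-zero {n} t t≡0 = trans (sum-cong-≗ t≡0) (sum-replicate-zero n)

  sum-single : ∀ {n} (t : Fin n → ℤ) k₀ → (∀ k → k ≢ k₀ → t k ≡ + 0) → sum t ≡ t k₀
  sum-single {suc n} t k₀ others = begin
    sum t                                 ≡⟨ sum-remove {i = k₀} t ⟩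
    t k₀ + sum (t ∘ punchIn k₀)           ≡⟨ cong (_+_ (t k₀)) (sum-zero (t ∘ punchIn k₀) λ k → others _ (punchInᵢ≢i k₀ k)) ⟩
    t k₀ + + 0                            ≡⟨ ℤP.+-identityʳ (t k₀) ⟩
    t k₀                                  ∎
    where open ≡-Reasoning

  Dependent : ∀ {d e} → (Fin d → Fin e → ℤ) → Set
  Dependent {d} v = ∃ λ (a : Fin d → ℤ) → (∀ j → ∑[ k < d ] (a k * v k j) ≡ + 0) × ∃[ k ] a k ≢ + 0

  eliminate : ∀ {d e} → (Fin (suc d) → Fin (suc e) → ℤ) → Fin (suc d) → Fin d → Fin e → ℤ
  eliminate v k₁ k j = v k₁ zero * v (punchIn k₁ k) (suc j) - v (punchIn k₁ k) zero * v k₁ (suc j)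

  -- More than e vectors in ℤᵉ are linearly dependent (Gaussian elimination
  -- on the first coordinate, by induction on e).
  dependent : ∀ {d e} (v : Fin d → Fin e → ℤ) → e < d → Dependent v
  dependent {suc d} {zero} v _ = (λ _ → + 1) , (λ ()) , zero , λ ()
  dependent {suc d} {suc e} v (s≤s e<d) with any? (λ k → ¬? (v k zero ℤP.≟ + 0))
  -- if all first coordinates vanish, a relation among the other coordinates will do
  ... | no all-zero with dependent (λ k j → v k (suc j)) (ℕP.m<n⇒m<1+n e<d)
  ...   | a , tail-relation , nonzero = a , relation , nonzero
    where
    relation : ∀ j → ∑[ k < suc d ] (a k * v k j) ≡ + 0
    relation zero = sum-zero (λ k → a k * v k zero) λ k →
      trans (cong (a k *_) (decidable-stable (v k zero ℤP.≟ + 0) (λ v≢0 → all-zero (k , v≢0)))) (ℤP.*-zeroʳ (a k))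
    relation (suc j) = tail-relation j
  -- otherwise combine a relation b among the eliminated vectors with v k₁
  dependent {suc d} {suc e} v (s≤s e<d) | yes (k₁ , p≢0) with dependent (eliminate v k₁) e<d
  ...   | b , b-relation , k₂ , b≢0 = a , relation , punchIn k₁ k₂ , nonzero
    where
    p S₀ : ℤ
    p = v k₁ zero
    S₀ = ∑[ k < d ] (b k * v (punchIn k₁ k) zero)
    a : Fin (suc d) → ℤ
    a = insertAt (λ k → p * b k) k₁ (- S₀)
    nonzero : a (punchIn k₁ k₂) ≢ + 0
    nonzero a≡0 with ℤP.i*j≡0⇒i≡0∨j≡0 p (trans (sym (insertAt-punchIn (λ k → p * b k) k₁ (- S₀) k₂)) a≡0)
    ... | inj₁ p≡0 = p≢0 p≡0
    ... | inj₂ b≡0 = b≢0 b≡0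
    split : ∀ j → ∑[ k < suc d ] (a k * v k j) ≡ - S₀ * v k₁ j + p * ∑[ k < d ] (b k * v (punchIn k₁ k) j)
    split j = begin
      ∑[ k < suc d ] (a k * v k j)                                          ≡⟨ sum-remove {i = k₁} (λ k → a k * v k j) ⟩
      a k₁ * v k₁ j + ∑[ k < d ] (a (punchIn k₁ k) * v (punchIn k₁ k) j)    ≡⟨ cong₂ (λ x y → x * v k₁ j + y) (insertAt-lookup _ k₁ (- S₀))
                                                                                 (sum-cong-≗ λ k → cong (_* v (punchIn k₁ k) j) (insertAt-punchIn _ k₁ (- S₀) k)) ⟩
      - S₀ * v k₁ j + ∑[ k < d ] (p * b k * v (punchIn k₁ k) j)             ≡⟨ cong (_+_ (- S₀ * v k₁ j)) (sum-cong-≗ λ k → ℤP.*-assoc p (b k) _) ⟩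
      - S₀ * v k₁ j + ∑[ k < d ] (p * (b k * v (punchIn k₁ k) j))           ≡⟨ cong (_+_ (- S₀ * v k₁ j)) (*-distribˡ-sum p (λ k → b k * v (punchIn k₁ k) j)) ⟨
      - S₀ * v k₁ j + p * ∑[ k < d ] (b k * v (punchIn k₁ k) j)             ∎
      where open ≡-Reasoning
    relation : ∀ j → ∑[ k < suc d ] (a k * v k j) ≡ + 0
    relation zero = trans (split zero) (lemma S₀ p)
      where
      lemma : ∀ S p → - S * p + p * S ≡ + 0
      lemma = solve-∀
    relation (suc j) = begin
      ∑[ k < suc d ] (a k * v k (suc j))                              ≡⟨ split (suc j) ⟩
      - S₀ * V + p * ∑[ k < d ] (b k * w k)                           ≡⟨ lemma S₀ V p _ ⟩
      p * ∑[ k < d ] (b k * w k) + - V * S₀                           ≡⟨ cong₂ _+_ (*-distribˡ-sum p (λ k → b k * w k)) (*-distribˡ-sum (- V) (λ k → b k * w₀ k)) ⟩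
      ∑[ k < d ] (p * (b k * w k)) + ∑[ k < d ] (- V * (b k * w₀ k))  ≡⟨ ∑-distrib-+ (λ k → p * (b k * w k)) (λ k → - V * (b k * w₀ k)) ⟨
      ∑[ k < d ] (p * (b k * w k) + - V * (b k * w₀ k))               ≡⟨ sum-cong-≗ (λ k → lemma′ p (b k) (w k) V (w₀ k)) ⟩
      ∑[ k < d ] (b k * eliminate v k₁ k j)                           ≡⟨ b-relation j ⟩
      + 0                                                             ∎
      where
      open ≡-Reasoning
      V : ℤ
      V = v k₁ (suc j)
      w w₀ : Fin d → ℤ
      w k = v (punchIn k₁ k) (suc j)
      w₀ k = v (punchIn k₁ k) zero
      lemma : ∀ S V p X → - S * V + p * X ≡ p * X + - V * S
      lemma = solve-∀
      lemma′ : ∀ p b x V y → p * (b * x) + - V * (b * y) ≡ b * (p * x - y * V)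
      lemma′ = solve-∀

module LinearCombinations where

  open Chains
  open LinearAlgebra
  open import Data.Fin using (Fin; zero; suc)
  open import Data.Integer using (ℤ; _+_; _*_)
  open import Data.List using (tabulate; concatMap)

  coeff-concatMap : ∀ {A : Set} {r} (f : Fin r → A) (G : A → Chain) S →
    coeff (concatMap G (tabulate f)) S ≡ ∑[ k < r ] coeff (G (f k)) S
  coeff-concatMap {r = zero} f G S = refl
  coeff-concatMap {r = suc r} f G S =
    trans (coeff-++ (G (f zero)) (concatMap G (tabulate (f ∘ suc))) S)
          (cong (_+_ (coeff (G (f zero)) S)) (coeff-concatMap (f ∘ suc) G S))

  coeff-lincomb : ∀ {r} (c : Fin r → ℤ) (b : Fin r → Chain) S →
    coeff (lincomb c b) S ≡ ∑[ k < r ] (c k * coeff (b k) S)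
  coeff-lincomb c b S =
    trans (coeff-concatMap (λ k → k) (λ k → scale (c k) (b k)) S)
          (sum-cong-≗ λ k → coeff-scale (c k) (b k) S)

  lin-concatMap : ∀ {A : Set} {r} F (f : Fin r → A) (G : A → Chain) →
    lin F (concatMap G (tabulate f)) ≡ concatMap (lin F ∘ G) (tabulate f)
  lin-concatMap {r = zero} F f G = refl
  lin-concatMap {r = suc r} F f G =
    trans (lin-++ F (G (f zero)) _) (cong (lin F (G (f zero)) ++_) (lin-concatMap F (f ∘ suc) G))

  coeff-lin-lincomb : ∀ F {r} (a : Fin r → ℤ) (w : Fin r → Chain) S →
    coeff (lin F (lincomb a w)) S ≡ ∑[ k < r ] (a k * coeff (lin F (w k)) S)
  coeff-lin-lincomb F a w S =
    trans (cong (λ u → coeff u S) (lin-concatMap F (λ k → k) (λ k → scale (a k) (w k))))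
    (trans (coeff-concatMap (λ k → k) (λ k → lin F (scale (a k) (w k))) S)
           (sum-cong-≗ λ k → trans (lin-scale F (a k) (w k) S) (coeff-scale (a k) (lin F (w k)) S)))

  Supported-lincomb : ∀ {P r} (a : Fin r → ℤ) (w : Fin r → Chain) → (∀ k → Supported P (w k)) →
    Supported P (lincomb a w)
  Supported-lincomb {P} {r} a w supp = go (λ k → k) (λ k → Supported-scale (a k) (supp k))
    where
    go : ∀ {r′} (f : Fin r′ → Fin r) → (∀ k → Supported P (scale (a (f k)) (w (f k)))) →
      Supported P (concatMap (λ k → scale (a k) (w k)) (tabulate f))
    go {r′ = zero} f _ = []
    go {r′ = suc r′} f supp′ = Supported-++ (supp′ zero) (go (f ∘ suc) (supp′ ∘ suc))

-- Any two bases of H_i have the same number of elements: expanding the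
-- elements of one basis b in another basis b′, a surplus of elements of b
-- would give a non-trivial relation among the classes of b.
module RankInvariance (m n i : ℕ) where

  open Chains
  open LinearAlgebra
  open LinearCombinations
  open import Data.Nat using (_≤_; _≤?_)
  import Data.Nat.Properties as ℕP
  open import Data.Fin using (Fin)
  open import Data.Integer using (ℤ; +_; _+_; _*_)
  import Data.Integer.Properties as ℤP
  open import Relation.Nullary using (contradiction)

  basis-size-≤ : ∀ {d e} (b : Fin d → Chain) (b′ : Fin e → Chain) →
    IsHomologyBasis m n i b → IsHomologyBasis m n i b′ → d ≤ e
  basis-size-≤ {d} {e} b b′ (cycles , _ , independent) (_ , spans′ , _) with d ≤? e
  ... | yes d≤e = d≤e
  ... | no d≰e = contradiction (independent a W W-chain relation k₀) a≢0
    where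
    expand : ∀ k → ∃[ c ] ∃[ w ] (IsChain m n (suc i) w × (b k ≈ (lincomb c b′ ++ ∂ m w)))
    expand k = spans′ (b k) (proj₁ (cycles k)) (proj₂ (cycles k))
    c : Fin d → Fin e → ℤ
    c k = proj₁ (expand k)
    w : Fin d → Chain
    w k = proj₁ (proj₂ (expand k))
    dep : Dependent c
    dep = dependent c (ℕP.≰⇒> d≰e)
    a : Fin d → ℤ
    a = proj₁ dep
    k₀ : Fin d
    k₀ = proj₁ (proj₂ (proj₂ dep))
    a≢0 : a k₀ ≢ + 0
    a≢0 = proj₂ (proj₂ (proj₂ dep))
    W : Chain
    W = lincomb a w
    W-chain : IsChain m n (suc i) W
    W-chain = Supported-lincomb a w (λ k → proj₁ (proj₂ (proj₂ (expand k))))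
    b′-part : ∀ S → ∑[ k < d ] (a k * coeff (lincomb (c k) b′) S) ≡ + 0
    b′-part S = begin
      ∑[ k < d ] (a k * coeff (lincomb (c k) b′) S)                  ≡⟨ sum-cong-≗ (λ k → cong (a k *_) (coeff-lincomb (c k) b′ S)) ⟩
      ∑[ k < d ] (a k * ∑[ j < e ] (c k j * coeff (b′ j) S))         ≡⟨ sum-cong-≗ distribute ⟩
      ∑[ k < d ] ∑[ j < e ] (a k * c k j * coeff (b′ j) S)           ≡⟨ ∑-comm (λ k j → a k * c k j * coeff (b′ j) S) ⟩
      ∑[ j < e ] ∑[ k < d ] (a k * c k j * coeff (b′ j) S)           ≡⟨ sum-cong-≗ (λ j → sym (*-distribʳ-sum (coeff (b′ j) S) (λ k → a k * c k j))) ⟩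
      ∑[ j < e ] (∑[ k < d ] (a k * c k j) * coeff (b′ j) S)         ≡⟨ sum-zero _ (λ j → cong (_* coeff (b′ j) S) (proj₁ (proj₂ dep) j)) ⟩
      + 0                                                            ∎
      where
      open ≡-Reasoning
      distribute : ∀ k → a k * ∑[ j < e ] (c k j * coeff (b′ j) S) ≡ ∑[ j < e ] (a k * c k j * coeff (b′ j) S)
      distribute k = trans (*-distribˡ-sum (a k) (λ j → c k j * coeff (b′ j) S))
                           (sum-cong-≗ λ j → sym (ℤP.*-assoc (a k) (c k j) (coeff (b′ j) S)))
    relation : lincomb a b ≈ ∂ m W
    relation S = begin
      coeff (lincomb a b) S                                               ≡⟨ coeff-lincomb a b S ⟩
      ∑[ k < d ] (a k * coeff (b k) S)                                    ≡⟨ sum-cong-≗ (λ k → cong (a k *_) (expansion k)) ⟩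
      ∑[ k < d ] (a k * (coeff (lincomb (c k) b′) S + coeff (∂ m (w k)) S))
                                                                           ≡⟨ sum-cong-≗ (λ k → ℤP.*-distribˡ-+ (a k) (coeff (lincomb (c k) b′) S) (coeff (∂ m (w k)) S)) ⟩
      ∑[ k < d ] (a k * coeff (lincomb (c k) b′) S + a k * coeff (∂ m (w k)) S)
                                                                           ≡⟨ ∑-distrib-+ (λ k → a k * coeff (lincomb (c k) b′) S) (λ k → a k * coeff (∂ m (w k)) S) ⟩
      ∑[ k < d ] (a k * coeff (lincomb (c k) b′) S) + ∑[ k < d ] (a k * coeff (∂ m (w k)) S)
                                                                           ≡⟨ cong (_+ ∑[ k < d ] (a k * coeff (∂ m (w k)) S)) (b′-part S) ⟩
      + 0 + ∑[ k < d ] (a k * coeff (∂ m (w k)) S)                        ≡⟨ ℤP.+-identityˡ _ ⟩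
      ∑[ k < d ] (a k * coeff (∂ m (w k)) S)                              ≡⟨ sum-cong-≗ (λ k → cong (λ u → a k * coeff u S) (∂≡lin m (w k))) ⟩
      ∑[ k < d ] (a k * coeff (lin (∂₁ m) (w k)) S)                       ≡⟨ coeff-lin-lincomb (∂₁ m) a w S ⟨
      coeff (lin (∂₁ m) W) S                                              ≡⟨ cong (λ u → coeff u S) (∂≡lin m W) ⟨
      coeff (∂ m W) S                                                     ∎
      where
      open ≡-Reasoning
      expansion : ∀ k → coeff (b k) S ≡ coeff (lincomb (c k) b′) S + coeff (∂ m (w k)) S
      expansion k = trans (proj₂ (proj₂ (proj₂ (expand k))) S) (coeff-++ (lincomb (c k) b′) (∂ m (w k)) S)

  basis-size-unique : ∀ {d e} (b : Fin d → Chain) (b′ : Fin e → Chain) →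
    IsHomologyBasis m n i b → IsHomologyBasis m n i b′ → d ≡ e
  basis-size-unique b b′ basis basis′ =
    ℕP.≤-antisym (basis-size-≤ b b′ basis basis′) (basis-size-≤ b′ b basis′ basis)

module HomologyBasis (m n i : ℕ) (L : List Placement) (unique : Unique L)
                     (char : ∀ T → (T ∈ L) ⇔ Special m n i T) where

  open Chains
  open Homotopy m
  open Support m
  open LinearAlgebra
  open LinearCombinations
  open import Data.Fin using (Fin; zero; suc)
  open import Data.Integer using (ℤ; +_; _+_; _*_)
  import Data.Integer.Properties as ℤP
  open import Data.List using (lookup)
  open import Data.List.Relation.Unary.AllPairs using (_∷_)
  open import Data.List.Relation.Unary.Any using (index)
  open import Data.List.Relation.Unary.Any.Properties using (lookup-index)
  open import Data.List.Membership.Propositional.Properties using (∈-lookup)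
  open import Data.List.Membership.DecPropositional _≟P_ using (_∈?_)
  open import Relation.Nullary using (contradiction)
  open Function.Bundles.Equivalence

  lookup-injective : ∀ (L : List Placement) → Unique L → ∀ k k′ → lookup L k ≡ lookup L k′ → k ≡ k′
  lookup-injective (_ ∷ _) (_ ∷ _) zero zero _ = refl
  lookup-injective (_ ∷ _) (distinct ∷ _) zero (suc k′) eq = contradiction eq (All.lookup distinct (∈-lookup k′))
  lookup-injective (_ ∷ _) (distinct ∷ _) (suc k) zero eq = contradiction (sym eq) (All.lookup distinct (∈-lookup k))
  lookup-injective (_ ∷ L) (_ ∷ unique) (suc k) (suc k′) eq = cong suc (lookup-injective L unique k k′ eq)

  b : Fin (length L) → Chain
  b k = unit (lookup L k)

  special : ∀ k → Special m n i (lookup L k)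
  special k = to (char (lookup L k)) (∈-lookup k)

  coeff-lincomb-∈ : ∀ (c : Fin (length L) → ℤ) k₀ → coeff (lincomb c b) (lookup L k₀) ≡ c k₀
  coeff-lincomb-∈ c k₀ = begin
    coeff (lincomb c b) (lookup L k₀)                       ≡⟨ coeff-lincomb c b (lookup L k₀) ⟩
    ∑[ k < length L ] (c k * coeff (b k) (lookup L k₀))     ≡⟨ sum-single _ k₀ others ⟩
    c k₀ * coeff (b k₀) (lookup L k₀)                       ≡⟨ cong (c k₀ *_) (coeff-hit (+ 1) (lookup L k₀) []) ⟩
    c k₀ * (+ 1 + + 0)                                      ≡⟨ ℤP.*-identityʳ (c k₀) ⟩
    c k₀                                                    ∎
    where
    open ≡-Reasoning
    others : ∀ k → k ≢ k₀ → c k * coeff (b k) (lookup L k₀) ≡ + 0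
    others k k≢k₀ = trans (cong (c k *_) (coeff-miss (+ 1) (lookup L k) [] (lookup L k₀)
                                           (k≢k₀ ∘ lookup-injective L unique k k₀)))
                          (ℤP.*-zeroʳ (c k))

  coeff-lincomb-∉ : ∀ (c : Fin (length L) → ℤ) S → S ∉ L → coeff (lincomb c b) S ≡ + 0
  coeff-lincomb-∉ c S S∉L = trans (coeff-lincomb c b S) (sum-zero _ λ k →
    trans (cong (c k *_) (coeff-miss (+ 1) (lookup L k) [] S λ eq → S∉L (subst (_∈ L) eq (∈-lookup k))))
          (ℤP.*-zeroʳ (c k)))

  coeffs : Chain → Fin (length L) → ℤ
  coeffs z k = coeff z (lookup L k)

  π-lincomb : ∀ z → IsChain m n i z → π z ≈ lincomb (coeffs z) b
  π-lincomb z z-chain S with All.all? topShaded? S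
  ... | no ¬special-S =
    trans (coeff-π-nonspecial z S ¬special-S)
          (sym (coeff-lincomb-∉ (coeffs z) S λ S∈L → ¬special-S (proj₂ (proj₂ (to (char S) S∈L)))))
  ... | yes special-S with S ∈? L
  ...   | yes S∈L rewrite lookup-index S∈L =
    trans (coeff-π-special z _ special-S) (sym (coeff-lincomb-∈ (coeffs z) (index S∈L)))
  ...   | no S∉L = begin
    coeff (π z) S                                        ≡⟨ coeff-π-special z S special-S ⟩
    coeff z S                                            ≡⟨ coeff-unsupported z S z-chain (λ (valid , rank≡i) → S∉L (from (char S) (valid , rank≡i , special-S))) ⟩
    + 0                                                  ≡⟨ coeff-lincomb-∉ (coeffs z) S S∉L ⟨
    coeff (lincomb (coeffs z) b) S                       ∎
    where open ≡-Reasoning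

  on-board : ∀ {j} z → IsChain m n j z → Supported (All (OnBoard m)) z
  on-board z = All.map λ ((_ , ons , _) , _) → ons

  basis : IsHomologyBasis m n i b
  basis = cycles , spanning , independent
    where
    cycles : ∀ k → IsChain m n i (b k) × (∂ m (b k) ≈ [])
    cycles k with special k
    ... | valid , rank≡i , special-T =
      ((valid , rank≡i) ∷ []) , λ S → cong (λ u → coeff (scale (+ 1) u ++ []) S) (∂₁-special _ special-T)

    -- by the homotopy identity, a cycle z is π z + ∂ (h z)
    spanning : ∀ z → IsChain m n i z → ∂ m z ≈ [] →
      ∃[ c ] ∃[ w ] (IsChain m n (suc i) w × (z ≈ (lincomb c b ++ ∂ m w)))
    spanning z z-chain cycle = c , h z , h-chain n i z z-chain , z≈
      where
      c : Fin (length L) → ℤ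
      c = coeffs z
      h∂z+πz≈ : (h (∂′ z) ++ π z) ≈ lincomb c b
      h∂z+πz≈ = ++-cong {h (∂′ z)} {[]} {π z} {lincomb c b}
                        (lin-null h₁ (∂′ z) (λ S → trans (cong (λ u → coeff u S) (sym (∂≡lin m z))) (cycle S)))
                        (π-lincomb z z-chain)
      z≈ : z ≈ (lincomb c b ++ ∂ m (h z))
      z≈ S = begin
        coeff z S                                             ≡⟨ homotopy z (on-board z z-chain) S ⟨
        coeff (∂′ (h z) ++ (h (∂′ z) ++ π z)) S               ≡⟨ ++-cong {∂′ (h z)} {∂′ (h z)} (λ _ → refl) h∂z+πz≈ S ⟩
        coeff (∂′ (h z) ++ lincomb c b) S                     ≡⟨ ++-comm (∂′ (h z)) (lincomb c b) S ⟩
        coeff (lincomb c b ++ ∂′ (h z)) S                     ≡⟨ cong (λ u → coeff (lincomb c b ++ u) S) (∂≡lin m (h z)) ⟨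
        coeff (lincomb c b ++ ∂ m (h z)) S                    ∎
        where open ≡-Reasoning

    -- boundaries have no special placements in their support
    independent : ∀ (c : Fin (length L) → ℤ) w → IsChain m n (suc i) w → lincomb c b ≈ ∂ m w →
      ∀ k → c k ≡ + 0
    independent c w w-chain c≈∂w k = begin
      c k                                   ≡⟨ coeff-lincomb-∈ c k ⟨
      coeff (lincomb c b) (lookup L k)      ≡⟨ c≈∂w (lookup L k) ⟩
      coeff (∂ m w) (lookup L k)            ≡⟨ cong (λ u → coeff u (lookup L k)) (∂≡lin m w) ⟩
      coeff (∂′ w) (lookup L k)             ≡⟨ coeff-unsupported (∂′ w) (lookup L k)
                                                 (Supported-lin (∂₁ m) ∂₁-nonspecial (on-board w w-chain))
                                                 (λ ¬special → ¬special (proj₂ (proj₂ (special k)))) ⟩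
      + 0                                   ∎
      where open ≡-Reasoning

module Polynomials where

  open import Level using (0ℓ)
  open import Data.Nat using (_+_; _*_; _∸_)
  open import Data.Nat.ListAction using (sum)
  import Data.Nat.Properties as ℕP
  open import Data.Nat.Tactic.RingSolver using (solve-∀)
  open import Algebra.Bundles using (CommutativeSemiring)
  open import Algebra.Structures.Biased using (IsCommutativeSemiringˡ)
  open import Relation.Binary.Structures using (IsEquivalence)
  open import Relation.Binary.Bundles using (Setoid)
  import Relation.Binary.Reasoning.Setoid as SetoidReasoning

  -- Equality of all coefficients (a record, so that p and q can be inferred).
  infix 4 _≐_
  record _≐_ (p q : Poly) : Set where
    constructor coeffwise
    field at : ∀ i → pcoeff p i ≡ pcoeff q i
  open _≐_ public

  ≐-isEquivalence : IsEquivalence _≐_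
  ≐-isEquivalence = record
    { refl = coeffwise λ _ → refl
    ; sym = λ p≐q → coeffwise λ i → sym (at p≐q i)
    ; trans = λ p≐q q≐r → coeffwise λ i → trans (at p≐q i) (at q≐r i) }

  open IsEquivalence ≐-isEquivalence public using () renaming (refl to ≐-refl; sym to ≐-sym; trans to ≐-trans)

  polySetoid : Setoid 0ℓ 0ℓ
  polySetoid = record { isEquivalence = ≐-isEquivalence }

  ≡⇒≐ : ∀ {p q} → p ≡ q → p ≐ q
  ≡⇒≐ refl = ≐-refl

  pcoeff-padd : ∀ p q i → pcoeff (padd p q) i ≡ pcoeff p i + pcoeff q i
  pcoeff-padd [] q i = refl
  pcoeff-padd (a ∷ p) [] i = sym (ℕP.+-identityʳ _)
  pcoeff-padd (a ∷ p) (b ∷ q) zero = refl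
  pcoeff-padd (a ∷ p) (b ∷ q) (suc i) = pcoeff-padd p q i

  pcoeff-scale : ∀ a q i → pcoeff (map (a *_) q) i ≡ a * pcoeff q i
  pcoeff-scale a [] i = sym (ℕP.*-zeroʳ a)
  pcoeff-scale a (b ∷ q) zero = refl
  pcoeff-scale a (b ∷ q) (suc i) = pcoeff-scale a q i

  pcoeff-pmul-∷ : ∀ a p q i → pcoeff (pmul (a ∷ p) q) i ≡ a * pcoeff q i + pcoeff (0 ∷ pmul p q) i
  pcoeff-pmul-∷ a p q i =
    trans (pcoeff-padd (map (a *_) q) (0 ∷ pmul p q) i) (cong (_+ pcoeff (0 ∷ pmul p q) i) (pcoeff-scale a q i))

  padd-cong : ∀ {p p′ q q′} → p ≐ p′ → q ≐ q′ → padd p q ≐ padd p′ q′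
  padd-cong {p} {p′} {q} {q′} p≐p′ q≐q′ = coeffwise λ i →
    trans (pcoeff-padd p q i) (trans (cong₂ _+_ (at p≐p′ i) (at q≐q′ i)) (sym (pcoeff-padd p′ q′ i)))

  padd-congʳ : ∀ p {q q′} → q ≐ q′ → padd p q ≐ padd p q′
  padd-congʳ p = padd-cong (≐-refl {p})

  padd-comm : ∀ p q → padd p q ≐ padd q p
  padd-comm p q = coeffwise λ i →
    trans (pcoeff-padd p q i) (trans (ℕP.+-comm (pcoeff p i) (pcoeff q i)) (sym (pcoeff-padd q p i)))

  padd-assoc : ∀ p q r → padd (padd p q) r ≐ padd p (padd q r)
  padd-assoc p q r = coeffwise λ i → begin
    pcoeff (padd (padd p q) r) i                ≡⟨ trans (pcoeff-padd (padd p q) r i) (cong (_+ pcoeff r i) (pcoeff-padd p q i)) ⟩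
    pcoeff p i + pcoeff q i + pcoeff r i        ≡⟨ ℕP.+-assoc (pcoeff p i) (pcoeff q i) (pcoeff r i) ⟩
    pcoeff p i + (pcoeff q i + pcoeff r i)      ≡⟨ trans (pcoeff-padd p (padd q r) i) (cong (pcoeff p i +_) (pcoeff-padd q r i)) ⟨
    pcoeff (padd p (padd q r)) i                ∎
    where open ≡-Reasoning

  padd-identityʳ : ∀ p → padd p [] ≐ p
  padd-identityʳ p = coeffwise λ i → trans (pcoeff-padd p [] i) (ℕP.+-identityʳ _)

  ∷-cong : ∀ {a p q} → p ≐ q → (a ∷ p) ≐ (a ∷ q)
  ∷-cong p≐q = coeffwise λ { zero → refl ; (suc i) → at p≐q i }

  scale-cong : ∀ a {p q} → p ≐ q → map (a *_) p ≐ map (a *_) q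
  scale-cong a {p} {q} p≐q = coeffwise λ i →
    trans (pcoeff-scale a p i) (trans (cong (a *_) (at p≐q i)) (sym (pcoeff-scale a q i)))

  scale-+ : ∀ a b q → map ((a + b) *_) q ≐ padd (map (a *_) q) (map (b *_) q)
  scale-+ a b q = coeffwise λ i → begin
    pcoeff (map ((a + b) *_) q) i                       ≡⟨ pcoeff-scale (a + b) q i ⟩
    (a + b) * pcoeff q i                                ≡⟨ ℕP.*-distribʳ-+ (pcoeff q i) a b ⟩
    a * pcoeff q i + b * pcoeff q i                     ≡⟨ cong₂ _+_ (pcoeff-scale a q i) (pcoeff-scale b q i) ⟨
    pcoeff (map (a *_) q) i + pcoeff (map (b *_) q) i   ≡⟨ pcoeff-padd (map (a *_) q) (map (b *_) q) i ⟨
    pcoeff (padd (map (a *_) q) (map (b *_) q)) i       ∎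
    where open ≡-Reasoning

  padd-interchange : ∀ x y z w → padd (padd x y) (padd z w) ≐ padd (padd x z) (padd y w)
  padd-interchange x y z w = coeffwise λ i →
    trans (expand x y z w i) (trans (lemma (pcoeff x i) (pcoeff y i) (pcoeff z i) (pcoeff w i)) (sym (expand x z y w i)))
    where
    expand : ∀ x y z w i → pcoeff (padd (padd x y) (padd z w)) i ≡ (pcoeff x i + pcoeff y i) + (pcoeff z i + pcoeff w i)
    expand x y z w i = trans (pcoeff-padd (padd x y) (padd z w) i) (cong₂ _+_ (pcoeff-padd x y i) (pcoeff-padd z w i))
    lemma : ∀ a b c d → (a + b) + (c + d) ≡ (a + c) + (b + d)
    lemma = solve-∀

  pmul-congʳ : ∀ p {q q′} → q ≐ q′ → pmul p q ≐ pmul p q′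
  pmul-congʳ [] q≐q′ = ≐-refl
  pmul-congʳ (a ∷ p) q≐q′ = padd-cong (scale-cong a q≐q′) (∷-cong (pmul-congʳ p q≐q′))

  pmul-nilʳ : ∀ p → pmul p [] ≐ []
  pmul-nilʳ [] = ≐-refl
  pmul-nilʳ (a ∷ p) = coeffwise λ { zero → refl ; (suc i) → at (pmul-nilʳ p) i }

  pmul-0∷ : ∀ p q → pmul (0 ∷ p) q ≐ (0 ∷ pmul p q)
  pmul-0∷ p q = coeffwise (pcoeff-pmul-∷ 0 p q)

  pmul-scaleˡ : ∀ a p q → pmul (map (a *_) p) q ≐ map (a *_) (pmul p q)
  pmul-scaleˡ a [] q = ≐-refl
  pmul-scaleˡ a (b ∷ p) q = coeffwise λ i → begin
    pcoeff (pmul ((a * b) ∷ map (a *_) p) q) i                   ≡⟨ pcoeff-pmul-∷ (a * b) (map (a *_) p) q i ⟩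
    a * b * pcoeff q i + pcoeff (0 ∷ pmul (map (a *_) p) q) i     ≡⟨ cong (a * b * pcoeff q i +_) (at (∷-cong (pmul-scaleˡ a p q)) i) ⟩
    a * b * pcoeff q i + pcoeff (0 ∷ map (a *_) (pmul p q)) i     ≡⟨ cong (a * b * pcoeff q i +_) (shifted-scale i) ⟩
    a * b * pcoeff q i + a * pcoeff (0 ∷ pmul p q) i              ≡⟨ lemma a b (pcoeff q i) _ ⟩
    a * (b * pcoeff q i + pcoeff (0 ∷ pmul p q) i)                ≡⟨ cong (a *_) (pcoeff-pmul-∷ b p q i) ⟨
    a * pcoeff (pmul (b ∷ p) q) i                                 ≡⟨ pcoeff-scale a (pmul (b ∷ p) q) i ⟨
    pcoeff (map (a *_) (pmul (b ∷ p) q)) i                        ∎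
    where
    open ≡-Reasoning
    lemma : ∀ a b x y → a * b * x + a * y ≡ a * (b * x + y)
    lemma = solve-∀
    shifted-scale : ∀ i → pcoeff (0 ∷ map (a *_) (pmul p q)) i ≡ a * pcoeff (0 ∷ pmul p q) i
    shifted-scale zero = sym (ℕP.*-zeroʳ a)
    shifted-scale (suc i) = pcoeff-scale a (pmul p q) i

  pmul-distribʳ : ∀ p p′ q → pmul (padd p p′) q ≐ padd (pmul p q) (pmul p′ q)
  pmul-distribʳ [] p′ q = ≐-refl
  pmul-distribʳ (a ∷ p) [] q = ≐-sym (padd-identityʳ _)
  pmul-distribʳ (a ∷ p) (a′ ∷ p′) q = begin
    padd (map ((a + a′) *_) q) (0 ∷ pmul (padd p p′) q)
      ≈⟨ padd-cong (scale-+ a a′ q) (∷-cong (pmul-distribʳ p p′ q)) ⟩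
    padd (padd (map (a *_) q) (map (a′ *_) q)) (padd (0 ∷ pmul p q) (0 ∷ pmul p′ q))
      ≈⟨ padd-interchange (map (a *_) q) (map (a′ *_) q) (0 ∷ pmul p q) (0 ∷ pmul p′ q) ⟩
    padd (pmul (a ∷ p) q) (pmul (a′ ∷ p′) q) ∎
    where open SetoidReasoning polySetoid

  padd-left-comm : ∀ x y z → padd x (padd y z) ≐ padd y (padd x z)
  padd-left-comm x y z = begin
    padd x (padd y z)   ≈⟨ padd-assoc x y z ⟨
    padd (padd x y) z   ≈⟨ padd-cong (padd-comm x y) (≐-refl {z}) ⟩
    padd (padd y x) z   ≈⟨ padd-assoc y x z ⟩
    padd y (padd x z)   ∎
    where open SetoidReasoning polySetoid

  ∷-cong₂ : ∀ {a b p q} → a ≡ b → p ≐ q → (a ∷ p) ≐ (b ∷ q)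
  ∷-cong₂ refl = ∷-cong

  pmul-consʳ : ∀ q a p → pmul q (a ∷ p) ≐ padd (map (a *_) q) (0 ∷ pmul q p)
  pmul-consʳ [] a p = coeffwise λ { zero → refl ; (suc i) → refl }
  pmul-consʳ (b ∷ q) a p = ∷-cong₂ (cong (_+ 0) (ℕP.*-comm b a)) (begin
    padd (map (b *_) p) (pmul q (a ∷ p))
      ≈⟨ padd-congʳ (map (b *_) p) (pmul-consʳ q a p) ⟩
    padd (map (b *_) p) (padd (map (a *_) q) (0 ∷ pmul q p))
      ≈⟨ padd-left-comm (map (b *_) p) (map (a *_) q) (0 ∷ pmul q p) ⟩
    padd (map (a *_) q) (pmul (b ∷ q) p) ∎)
    where open SetoidReasoning polySetoid

  pmul-comm : ∀ p q → pmul p q ≐ pmul q p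
  pmul-comm [] q = ≐-sym (pmul-nilʳ q)
  pmul-comm (a ∷ p) q = ≐-trans (padd-congʳ (map (a *_) q) (∷-cong (pmul-comm p q))) (≐-sym (pmul-consʳ q a p))

  pmul-cong : ∀ {p p′ q q′} → p ≐ p′ → q ≐ q′ → pmul p q ≐ pmul p′ q′
  pmul-cong {p} {p′} {q} {q′} p≐p′ q≐q′ = begin
    pmul p q     ≈⟨ pmul-congʳ p q≐q′ ⟩
    pmul p q′    ≈⟨ pmul-comm p q′ ⟩
    pmul q′ p    ≈⟨ pmul-congʳ q′ p≐p′ ⟩
    pmul q′ p′   ≈⟨ pmul-comm q′ p′ ⟩
    pmul p′ q′   ∎
    where open SetoidReasoning polySetoid

  pmul-congˡ : ∀ {p p′} q → p ≐ p′ → pmul p q ≐ pmul p′ q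
  pmul-congˡ q p≐p′ = pmul-cong p≐p′ (≐-refl {q})

  pmul-assoc : ∀ p q r → pmul (pmul p q) r ≐ pmul p (pmul q r)
  pmul-assoc [] q r = ≐-refl
  pmul-assoc (a ∷ p) q r = begin
    pmul (padd (map (a *_) q) (0 ∷ pmul p q)) r
      ≈⟨ pmul-distribʳ (map (a *_) q) (0 ∷ pmul p q) r ⟩
    padd (pmul (map (a *_) q) r) (pmul (0 ∷ pmul p q) r)
      ≈⟨ padd-cong (pmul-scaleˡ a q r) (≐-trans (pmul-0∷ (pmul p q) r) (∷-cong (pmul-assoc p q r))) ⟩
    padd (map (a *_) (pmul q r)) (0 ∷ pmul p (pmul q r)) ∎
    where open SetoidReasoning polySetoid

  pmul-identityˡ : ∀ q → pmul (1 ∷ []) q ≐ q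
  pmul-identityˡ q = coeffwise λ i → begin
    pcoeff (pmul (1 ∷ []) q) i       ≡⟨ pcoeff-pmul-∷ 1 [] q i ⟩
    1 * pcoeff q i + pcoeff (0 ∷ []) i ≡⟨ cong₂ _+_ (ℕP.*-identityˡ (pcoeff q i)) (zero-poly i) ⟩
    pcoeff q i + 0                     ≡⟨ ℕP.+-identityʳ (pcoeff q i) ⟩
    pcoeff q i                         ∎
    where
    open ≡-Reasoning
    zero-poly : ∀ i → pcoeff (0 ∷ []) i ≡ 0
    zero-poly zero = refl
    zero-poly (suc i) = refl

  pmul-distribˡ : ∀ p q q′ → pmul p (padd q q′) ≐ padd (pmul p q) (pmul p q′)
  pmul-distribˡ p q q′ = begin
    pmul p (padd q q′)            ≈⟨ pmul-comm p (padd q q′) ⟩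
    pmul (padd q q′) p            ≈⟨ pmul-distribʳ q q′ p ⟩
    padd (pmul q p) (pmul q′ p)   ≈⟨ padd-cong (pmul-comm q p) (pmul-comm q′ p) ⟩
    padd (pmul p q) (pmul p q′)   ∎
    where open SetoidReasoning polySetoid

  -- Hence polynomials form a commutative semiring (used by the ring solver).
  polySemiring : CommutativeSemiring 0ℓ 0ℓ
  polySemiring = record
    { Carrier = Poly ; _≈_ = _≐_ ; _+_ = padd ; _*_ = pmul ; 0# = [] ; 1# = 1 ∷ []
    ; isCommutativeSemiring = IsCommutativeSemiringˡ.isCommutativeSemiring (record
      { +-isCommutativeMonoid = record
        { isMonoid = record
          { isSemigroup = record
            { isMagma = record { isEquivalence = ≐-isEquivalence ; ∙-cong = padd-cong }
            ; assoc = padd-assoc }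
          ; identity = (λ _ → ≐-refl) , padd-identityʳ }
        ; comm = padd-comm }
      ; *-isCommutativeMonoid = record
        { isMonoid = record
          { isSemigroup = record
            { isMagma = record { isEquivalence = ≐-isEquivalence ; ∙-cong = pmul-cong }
            ; assoc = pmul-assoc }
          ; identity = pmul-identityˡ , λ q → ≐-trans (pmul-comm q (1 ∷ [])) (pmul-identityˡ q) }
        ; comm = pmul-comm }
      ; distribʳ = λ q p p′ → pmul-distribʳ p p′ q
      ; zeroˡ = λ _ → ≐-refl })
    }

  q^_ : ℕ → Poly
  q^ s = pshift s (1 ∷ [])

  pshift-q^ : ∀ s p → pshift s p ≐ pmul (q^ s) p
  pshift-q^ zero p = ≐-sym (pmul-identityˡ p)
  pshift-q^ (suc s) p = ≐-trans (∷-cong (pshift-q^ s p)) (≐-sym (pmul-0∷ (q^ s) p))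

  pshift-+ : ∀ a b p → pshift (a + b) p ≡ pshift a (pshift b p)
  pshift-+ zero b p = refl
  pshift-+ (suc a) b p = cong (0 ∷_) (pshift-+ a b p)

  q^-+ : ∀ a b → q^ (a + b) ≐ pmul (q^ a) (q^ b)
  q^-+ a b = ≐-trans (≡⇒≐ (pshift-+ a b (1 ∷ []))) (pshift-q^ a (q^ b))

  ptail : Poly → Poly
  ptail [] = []
  ptail (a ∷ p) = p

  ptail-cong : ∀ {p q} → p ≐ q → ptail p ≐ ptail q
  ptail-cong {p} {q} p≐q = coeffwise λ i → trans (at-tail p i) (trans (at p≐q (suc i)) (sym (at-tail q i)))
    where
    at-tail : ∀ p i → pcoeff (ptail p) i ≡ pcoeff p (suc i)
    at-tail [] i = refl
    at-tail (a ∷ p) i = refl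

  psq-cong : ∀ {p q} → p ≐ q → psq p ≐ psq q
  psq-cong {p} {q} p≐q = coeffwise (λ i → go i p q p≐q)
    where
    at-0 : ∀ p → pcoeff (psq p) 0 ≡ pcoeff p 0
    at-0 [] = refl
    at-0 (a ∷ p) = refl
    at-1 : ∀ p → pcoeff (psq p) 1 ≡ 0
    at-1 [] = refl
    at-1 (a ∷ p) = refl
    at-2+ : ∀ p i → pcoeff (psq p) (suc (suc i)) ≡ pcoeff (psq (ptail p)) i
    at-2+ [] i = refl
    at-2+ (a ∷ p) i = refl
    go : ∀ i p q → p ≐ q → pcoeff (psq p) i ≡ pcoeff (psq q) i
    go zero p q p≐q = trans (at-0 p) (trans (at p≐q 0) (sym (at-0 q)))
    go (suc zero) p q _ = trans (at-1 p) (sym (at-1 q))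
    go (suc (suc i)) p q p≐q =
      trans (at-2+ p i) (trans (go i (ptail p) (ptail q) (ptail-cong p≐q)) (sym (at-2+ q i)))

  psq-padd : ∀ p q → psq (padd p q) ≐ padd (psq p) (psq q)
  psq-padd [] q = ≐-refl
  psq-padd (a ∷ p) [] = ≐-refl
  psq-padd (a ∷ p) (b ∷ q) = ∷-cong (∷-cong (psq-padd p q))

  psq-scale : ∀ a p → psq (map (a *_) p) ≐ map (a *_) (psq p)
  psq-scale a [] = ≐-refl
  psq-scale a (b ∷ p) = ∷-cong (∷-cong₂ (sym (ℕP.*-zeroʳ a)) (psq-scale a p))

  psq-pmul : ∀ p q → psq (pmul p q) ≐ pmul (psq p) (psq q)
  psq-pmul [] q = ≐-refl
  psq-pmul (a ∷ p) q = begin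
    psq (padd (map (a *_) q) (0 ∷ pmul p q))
      ≈⟨ psq-padd (map (a *_) q) (0 ∷ pmul p q) ⟩
    padd (psq (map (a *_) q)) (0 ∷ 0 ∷ psq (pmul p q))
      ≈⟨ padd-cong (psq-scale a q) (∷-cong (∷-cong (psq-pmul p q))) ⟩
    padd (map (a *_) (psq q)) (0 ∷ 0 ∷ pmul (psq p) (psq q))
      ≈⟨ padd-congʳ (map (a *_) (psq q)) (∷-cong (pmul-0∷ (psq p) (psq q))) ⟨
    pmul (a ∷ 0 ∷ psq p) (psq q) ∎
    where open SetoidReasoning polySetoid

  psq-pshift : ∀ s p → psq (pshift s p) ≡ pshift (s + s) (psq p)
  psq-pshift zero p = refl
  psq-pshift (suc s) p =
    cong (0 ∷_) (trans (cong (0 ∷_) (psq-pshift s p)) (cong (λ k → pshift k (psq p)) (sym (ℕP.+-suc s s))))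

  [_]² : ℕ → Poly
  [ a ]² = psq (qint a)

  _!² : ℕ → Poly
  a !² = psq (qfact a)

  qint-+ : ∀ a b → qint (a + b) ≐ padd (qint a) (pshift a (qint b))
  qint-+ zero b = ≐-refl
  qint-+ (suc a) b = ∷-cong (qint-+ a b)

  []²-+ : ∀ a b → [ a + b ]² ≐ padd [ a ]² (pmul (q^ (a + a)) [ b ]²)
  []²-+ a b = begin
    psq (qint (a + b))                                 ≈⟨ psq-cong (qint-+ a b) ⟩
    psq (padd (qint a) (pshift a (qint b)))            ≈⟨ psq-padd (qint a) (pshift a (qint b)) ⟩
    padd [ a ]² (psq (pshift a (qint b)))              ≡⟨ cong (padd [ a ]²) (psq-pshift a (qint b)) ⟩
    padd [ a ]² (pshift (a + a) [ b ]²)                ≈⟨ padd-congʳ [ a ]² (pshift-q^ (a + a) [ b ]²) ⟩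
    padd [ a ]² (pmul (q^ (a + a)) [ b ]²)             ∎
    where open SetoidReasoning polySetoid

  !²-suc : ∀ a → (suc a) !² ≐ pmul (a !²) [ suc a ]²
  !²-suc a = psq-pmul (qfact a) (qint (suc a))

  0!² : 0 !² ≐ (1 ∷ [])
  0!² = coeffwise λ { zero → refl ; (suc zero) → refl ; (suc (suc i)) → refl }

  conv-pmul : ∀ (d : ℕ → ℕ) D p → (∀ t → d t ≡ pcoeff D t) → ∀ i → conv d p i ≡ pcoeff (pmul D p) i
  conv-pmul d D p d≡D i =
    trans (cong sum (ListP.map-applyUpTo (λ t → t) (λ t → d t * pcoeff p (i ∸ t)) (suc i))) (go d D i d≡D)
    where
    sum-zero : ∀ f n → (∀ t → f t ≡ 0) → sum (List.applyUpTo f n) ≡ 0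
    sum-zero f zero _ = refl
    sum-zero f (suc n) f≡0 = cong₂ _+_ (f≡0 0) (sum-zero (f ∘ suc) n (f≡0 ∘ suc))
    go : ∀ d D i → (∀ t → d t ≡ pcoeff D t) →
      sum (List.applyUpTo (λ t → d t * pcoeff p (i ∸ t)) (suc i)) ≡ pcoeff (pmul D p) i
    go d [] i d≡0 = sum-zero _ (suc i) λ t → cong (_* pcoeff p (i ∸ t)) (d≡0 t)
    go d (a ∷ D) zero d≡D =
      trans (cong (λ c → c * pcoeff p 0 + 0) (d≡D 0)) (sym (pcoeff-pmul-∷ a D p zero))
    go d (a ∷ D) (suc i) d≡D =
      trans (cong₂ (λ c s → c * pcoeff p (suc i) + s) (d≡D 0) (go (d ∘ suc) D i (d≡D ∘ suc)))
            (sym (pcoeff-pmul-∷ a D p (suc i)))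

module Sublists {A : Set} (_<_ : A → A → Set)
                (<-trans : ∀ {x y z} → x < y → y < z → x < z)
                (<-irrefl : ∀ {x} → ¬ x < x) where

  open import Data.Sum using (inj₁; inj₂)
  open import Data.List.Relation.Unary.Any using (here; there)
  open import Data.List.Relation.Unary.AllPairs using (AllPairs; []; _∷_)
  open import Data.List.Relation.Unary.Linked as Linked using (Linked; []; [-]; _∷_)
  open import Data.List.Membership.Propositional.Properties using (∈-map⁺; ∈-map⁻; ∈-++⁺ˡ; ∈-++⁺ʳ; ∈-++⁻)
  import Data.List.Relation.Unary.Unique.Propositional.Properties as Unique
  import Data.Nat.Properties as ℕP

  choose : List A → ℕ → List (List A)
  choose ys zero = [] ∷ []
  choose [] (suc n) = []
  choose (y ∷ ys) (suc n) = map (y ∷_) (choose ys n) ++ choose ys (suc n)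

  Increasing : List A → Set
  Increasing = Linked _<_

  Sorted : List A → Set
  Sorted = AllPairs _<_

  increasing-head : ∀ {t T} → Increasing (t ∷ T) → All (t <_) T
  increasing-head [-] = []
  increasing-head (t<t′ ∷ inc) = t<t′ ∷ All.map (<-trans t<t′) (increasing-head inc)

  choose-short : ∀ ys n → length ys ℕ.< n → choose ys n ≡ []
  choose-short [] (suc n) _ = refl
  choose-short (y ∷ ys) (suc n) (ℕ.s≤s len<n) =
    cong₂ (λ a b → map (y ∷_) a ++ b) (choose-short ys n len<n) (choose-short ys (suc n) (ℕP.m<n⇒m<1+n len<n))

  choose-sound : ∀ ys n T → Sorted ys → T ∈ choose ys n →
    (length T ≡ n) × All (_∈ ys) T × Increasing T
  choose-sound ys zero .[] _ (here refl) = refl , [] , []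
  choose-sound (y ∷ ys) (suc n) T (y<ys ∷ sorted) T∈ with ∈-++⁻ (map (y ∷_) (choose ys n)) T∈
  ... | inj₁ T∈left with ∈-map⁻ (y ∷_) T∈left
  ...   | T′ , T′∈ , refl with choose-sound ys n T′ sorted T′∈
  ...     | len , elems , inc = cong suc len , here refl ∷ All.map there elems , extend T′ elems inc
    where
    extend : ∀ T′ → All (_∈ ys) T′ → Increasing T′ → Increasing (y ∷ T′)
    extend [] _ _ = [-]
    extend (t ∷ _) (t∈ ∷ _) inc′ = All.lookup y<ys t∈ ∷ inc′
  choose-sound (y ∷ ys) (suc n) T (_ ∷ sorted) T∈ | inj₂ T∈right with choose-sound ys (suc n) T sorted T∈right
  ... | len , elems , inc = len , All.map there elems , inc

  drop-head : ∀ {y ys u} → u ∈ (y ∷ ys) → y < u → u ∈ ys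
  drop-head (here refl) y<y = ⊥-elim (<-irrefl y<y)
  drop-head (there u∈) _ = u∈

  choose-complete : ∀ ys T → Sorted ys → Increasing T → All (_∈ ys) T → T ∈ choose ys (length T)
  choose-complete [] [] _ _ _ = here refl
  choose-complete [] (t ∷ T) _ _ (() ∷ _)
  choose-complete (y ∷ ys) [] _ _ _ = here refl
  choose-complete (y ∷ ys) (t ∷ T) (_ ∷ sorted) inc (here refl ∷ T∈) =
    ∈-++⁺ˡ (∈-map⁺ (y ∷_) (choose-complete ys T sorted (Linked.tail inc)
                              (All.zipWith (λ (u∈ , y<u) → drop-head u∈ y<u) (T∈ , increasing-head inc))))
  choose-complete (y ∷ ys) (t ∷ T) (y<ys ∷ sorted) inc (there t∈ ∷ T∈) =
    ∈-++⁺ʳ (map (y ∷_) (choose ys (length T)))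
           (choose-complete ys (t ∷ T) sorted inc
              (t∈ ∷ All.zipWith (λ (u∈ , t<u) → drop-head u∈ (<-trans (All.lookup y<ys t∈) t<u))
                                (T∈ , increasing-head inc)))

  choose-unique : ∀ ys n → Sorted ys → Unique (choose ys n)
  choose-unique ys zero _ = [] ∷ []
  choose-unique [] (suc n) _ = []
  choose-unique (y ∷ ys) (suc n) (y<ys ∷ sorted) =
    Unique.++⁺ (Unique.map⁺ ListP.∷-injectiveʳ (choose-unique ys n sorted)) (choose-unique ys (suc n) sorted) disjoint
    where
    disjoint : ∀ {T} → T ∈ map (y ∷_) (choose ys n) × T ∈ choose ys (suc n) → ⊥
    disjoint (T∈left , T∈right) with ∈-map⁻ (y ∷_) T∈left
    ... | T′ , _ , refl with choose-sound ys (suc n) (y ∷ T′) sorted T∈right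
    ...   | _ , (y∈ys ∷ _) , _ = <-irrefl (All.lookup y<ys y∈ys)

-- The special placements: n-element sets of the shaded squares of row 1,
-- which are the squares sq t with 2t squares below them, t < ⌊m/2⌋.
module SpecialPlacements (m : ℕ) where

  open Homotopy m using (TopShaded; AllTopShaded)
  open Polynomials
  open import Data.Nat using (_+_; _*_; _∸_; _≤_; _<_; _/_; _≟_; s≤s; z≤n)
  open import Data.Nat.DivMod using (_%_; m≡m%n+[m/n]*n; m*n/n≡m; /-monoˡ-≤; m/n*n≤m)
  import Data.Nat.Properties as ℕP
  open import Data.Nat.Tactic.RingSolver using (solve-∀)
  open import Data.List using (filter; applyDownFrom)
  open import Data.Bool using (true; false)
  import Data.Bool
  open import Data.List.Relation.Unary.AllPairs using (AllPairs; []; _∷_)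
  open import Data.List.Membership.Propositional.Properties using (∈-filter⁺; ∈-filter⁻; ∈-applyDownFrom⁺; ∈-applyDownFrom⁻)
  import Data.List.Relation.Unary.Unique.Propositional.Properties as Unique
  import Relation.Binary.Reasoning.Setoid as SetoidReasoning

  K : ℕ
  K = m / 2

  K+K≤m : K + K ≤ m
  K+K≤m = subst (_≤ m) (trans (ℕP.*-comm K 2) (cong (K +_) (ℕP.+-identityʳ K))) (m/n*n≤m m 2)

  sq : ℕ → Square
  sq t = (1 , m ∸ suc (t + t))

  squares : ℕ → List Square
  squares = applyDownFrom sq

  below-sq : ∀ t → suc (t + t) ≤ m → below m (sq t) ≡ t + t
  below-sq t 2t<m = trans (sym (ℕP.pred[m∸n]≡m∸[1+n] m (m ∸ suc (t + t)))) (cong ℕ.pred (ℕP.m∸[m∸n]≡n 2t<m))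

  double-even : ∀ t → (t + t) % 2 ≡ 0
  double-even zero = refl
  double-even (suc t) = trans (cong (_% 2) (cong suc (ℕP.+-suc t t))) (double-even t)

  2t+1<m : ∀ {t} → t < K → suc (t + t) < m
  2t+1<m {t} t<K = ℕP.≤-trans (ℕP.≤-reflexive (cong suc (sym (ℕP.+-suc t t)))) (ℕP.≤-trans (ℕP.+-mono-≤ t<K t<K) K+K≤m)

  sq-special : ∀ {t} → t < K → OnBoard m (sq t) × TopShaded (sq t)
  sq-special {t} t<K =
    (ℕP.≤-refl , ℕP.m<n⇒0<n∸m (2t+1<m t<K) , ℕP.∸-monoʳ-< {m} {suc (t + t)} {0} (s≤s z≤n) (ℕP.<⇒≤ (2t+1<m t<K))) ,
    refl , trans (cong (_% 2) (below-sq t (ℕP.<⇒≤ (2t+1<m t<K)))) (double-even t)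

  special-square : ∀ {s} → OnBoard m s → TopShaded s → s ∈ squares K
  special-square {.1 , j} (_ , 1≤j , 1+j≤m) (refl , even) = subst (_∈ squares K) sq-t≡s (∈-applyDownFrom⁺ sq t<K)
    where
    b t : ℕ
    b = m ∸ suc j
    t = b / 2
    b≡t+t : b ≡ t + t
    b≡t+t = trans (m≡m%n+[m/n]*n b 2) (trans (cong (_+ t * 2) even) (lemma t))
      where
      lemma : ∀ t → 0 + t * 2 ≡ t + t
      lemma = solve-∀
    sq-t≡s : sq t ≡ (1 , j)
    sq-t≡s = cong (1 ,_) (trans (cong (λ u → m ∸ suc u) (sym b≡t+t))
                                (trans (sym (ℕP.pred[m∸n]≡m∸[1+n] m b)) (cong ℕ.pred (ℕP.m∸[m∸n]≡n 1+j≤m))))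
    2+2t≤m : suc t * 2 ≤ m
    2+2t≤m = begin
      suc t * 2          ≡⟨ lemma t ⟩
      (t + t) + 2        ≡⟨ cong (_+ 2) b≡t+t ⟨
      b + 2              ≤⟨ ℕP.+-monoʳ-≤ b (s≤s 1≤j) ⟩
      b + suc j          ≡⟨ ℕP.m∸n+n≡m 1+j≤m ⟩
      m                  ∎
      where
      open ℕP.≤-Reasoning
      lemma : ∀ t → suc t * 2 ≡ (t + t) + 2
      lemma = solve-∀
    t<K : t < K
    t<K = subst (_≤ K) (m*n/n≡m (suc t) 2) (/-monoˡ-≤ 2 2+2t≤m)

  -- The columns of sq t decrease with t.
  squares-sorted : ∀ k → k + k ≤ m → AllPairs (λ s t → col s < col t) (squares k)
  squares-sorted zero _ = []
  squares-sorted (suc k) 2k+2≤m = All.tabulate later ∷ squares-sorted k (ℕP.≤-trans (ℕP.+-mono-≤ (ℕP.n≤1+n k) (ℕP.n≤1+n k)) 2k+2≤m)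
    where
    2k+1<m : suc (k + k) < m
    2k+1<m = ℕP.≤-trans (ℕP.≤-reflexive (cong suc (sym (ℕP.+-suc k k)))) 2k+2≤m
    later : ∀ {s} → s ∈ squares k → col (sq k) < col s
    later s∈ with ∈-applyDownFrom⁻ sq s∈
    ... | t , t<k , refl = ℕP.∸-monoʳ-< (s≤s (ℕP.+-mono-< t<k t<k)) (ℕP.<⇒≤ 2k+1<m)

  open Sublists (λ s t → col s < col t) ℕP.<-trans (ℕP.<-irrefl refl)

  special⇔ : ∀ n T → T ∈ choose (squares K) n ⇔ (Valid m n T × AllTopShaded T)
  special⇔ n T = mk⇔ to from
    where
    sorted : AllPairs (λ s t → col s < col t) (squares K)
    sorted = squares-sorted K K+K≤m
    to : T ∈ choose (squares K) n → Valid m n T × AllTopShaded T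
    to T∈ with choose-sound (squares K) n T sorted T∈
    ... | len , elems , inc =
      (len , All.map (proj₁ ∘ special) elems , inc) , All.map (proj₂ ∘ special) elems
      where
      special : ∀ {s} → s ∈ squares K → OnBoard m s × TopShaded s
      special s∈ with ∈-applyDownFrom⁻ sq s∈
      ... | t , t<K , refl = sq-special t<K
    from : Valid m n T × AllTopShaded T → T ∈ choose (squares K) n
    from ((len , ons , inc) , tops) =
      subst (λ k → T ∈ choose (squares K) k) len
            (choose-complete (squares K) T sorted inc (All.zipWith (λ (on , top) → special-square on top) (ons , tops)))

  special-list : ℕ → ℕ → List Placement
  special-list n i = filter (λ T → rank m T ≟ i) (choose (squares K) n)

  special-list⇔ : ∀ n i T → T ∈ special-list n i ⇔ Special m n i T
  special-list⇔ n i T = mk⇔ to from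
    where
    to : T ∈ special-list n i → Special m n i T
    to T∈ with ∈-filter⁻ (λ T → rank m T ≟ i) T∈
    ... | T∈choose , rank≡i with Function.Bundles.Equivalence.to (special⇔ n T) T∈choose
    ...   | valid , tops = valid , rank≡i , tops
    from : Special m n i T → T ∈ special-list n i
    from (valid , rank≡i , tops) =
      ∈-filter⁺ (λ T → rank m T ≟ i) (Function.Bundles.Equivalence.from (special⇔ n T) (valid , tops)) rank≡i

  special-list-unique : ∀ n i → Unique (special-list n i)
  special-list-unique n i = Unique.filter⁺ (λ T → rank m T ≟ i) (choose-unique (squares K) n (squares-sorted K K+K≤m))

  weight : List Placement → Poly
  weight [] = []
  weight (T ∷ Ts) = padd (q^ (rank m T)) (weight Ts)

  pcoeff-q^-same : ∀ r → pcoeff (q^ r) r ≡ 1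
  pcoeff-q^-same zero = refl
  pcoeff-q^-same (suc r) = pcoeff-q^-same r

  pcoeff-q^-other : ∀ r i → r ≢ i → pcoeff (q^ r) i ≡ 0
  pcoeff-q^-other zero zero 0≢0 = ⊥-elim (0≢0 refl)
  pcoeff-q^-other zero (suc i) _ = refl
  pcoeff-q^-other (suc r) zero _ = refl
  pcoeff-q^-other (suc r) (suc i) r≢i = pcoeff-q^-other r i (r≢i ∘ cong suc)

  count : ∀ Ts i → length (filter (λ T → rank m T ≟ i) Ts) ≡ pcoeff (weight Ts) i
  count [] i = refl
  count (T ∷ Ts) i with rank m T ℕ.≡ᵇ i in eq
  ... | true = sym (trans (pcoeff-padd (q^ (rank m T)) (weight Ts) i)
                          (cong₂ _+_ (trans (cong (pcoeff (q^ (rank m T))) (sym r≡i)) (pcoeff-q^-same (rank m T)))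
                                     (sym (count Ts i))))
    where
    r≡i : rank m T ≡ i
    r≡i = ℕP.≡ᵇ⇒≡ (rank m T) i (subst Data.Bool.T (sym eq) _)
  ... | false = sym (trans (pcoeff-padd (q^ (rank m T)) (weight Ts) i)
                           (cong₂ _+_ (pcoeff-q^-other (rank m T) i r≢i) (sym (count Ts i))))
    where
    r≢i : rank m T ≢ i
    r≢i r≡i = subst Data.Bool.T eq (ℕP.≡⇒≡ᵇ (rank m T) i r≡i)

  G : ℕ → ℕ → Poly
  G k n = weight (choose (squares k) n)

  count-special : ∀ n i → length (special-list n i) ≡ pcoeff (G K n) i
  count-special n i = count (choose (squares K) n) i

  weight-++ : ∀ Ts Us → weight (Ts ++ Us) ≐ padd (weight Ts) (weight Us)
  weight-++ [] Us = ≐-refl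
  weight-++ (T ∷ Ts) Us =
    ≐-trans (padd-congʳ (q^ (rank m T)) (weight-++ Ts Us)) (≐-sym (padd-assoc (q^ (rank m T)) (weight Ts) (weight Us)))

  weight-∷ : ∀ s Ts → weight (map (s ∷_) Ts) ≐ pmul (q^ (below m s)) (weight Ts)
  weight-∷ s [] = ≐-sym (pmul-nilʳ (q^ (below m s)))
  weight-∷ s (T ∷ Ts) = begin
    padd (q^ (below m s + rank m T)) (weight (map (s ∷_) Ts))
      ≈⟨ padd-cong (q^-+ (below m s) (rank m T)) (weight-∷ s Ts) ⟩
    padd (pmul (q^ (below m s)) (q^ (rank m T))) (pmul (q^ (below m s)) (weight Ts))
      ≈⟨ pmul-distribˡ (q^ (below m s)) (q^ (rank m T)) (weight Ts) ⟨
    pmul (q^ (below m s)) (padd (q^ (rank m T)) (weight Ts)) ∎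
    where open SetoidReasoning polySetoid

  G-0 : ∀ k → G k 0 ≐ (1 ∷ [])
  G-0 k = padd-identityʳ (1 ∷ [])

  G-vanish : ∀ k n → k < n → G k n ≐ []
  G-vanish k n k<n = ≡⇒≐ (cong weight (choose-short (squares k) n (subst (_< n) (sym (ListP.length-applyDownFrom sq k)) k<n)))

  -- q-Pascal recursion: either sq k is used or it is not.
  G-pascal : ∀ k n → suc (k + k) ≤ m → G (suc k) (suc n) ≐ padd (pmul (q^ (k + k)) (G k n)) (G k (suc n))
  G-pascal k n 2k<m = begin
    weight (map (sq k ∷_) (choose (squares k) n) ++ choose (squares k) (suc n))
      ≈⟨ weight-++ (map (sq k ∷_) (choose (squares k) n)) (choose (squares k) (suc n)) ⟩
    padd (weight (map (sq k ∷_) (choose (squares k) n))) (G k (suc n))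
      ≈⟨ padd-cong (weight-∷ (sq k) (choose (squares k) n)) (≐-refl {G k (suc n)}) ⟩
    padd (pmul (q^ (below m (sq k))) (G k n)) (G k (suc n))
      ≡⟨ cong (λ e → padd (pmul (q^ e) (G k n)) (G k (suc n))) (below-sq k 2k<m) ⟩
    padd (pmul (q^ (k + k)) (G k n)) (G k (suc n)) ∎
    where open SetoidReasoning polySetoid

module QBinomial (m : ℕ) where

  open SpecialPlacements m
  open Polynomials
  open import Data.Nat using (_+_; _*_; _∸_; _≤_; s≤s)
  import Data.Nat.Properties as ℕP
  open import Data.Nat.Tactic.RingSolver using (solve-∀)
  open import Data.Maybe using (nothing)
  open import Data.Sum using (inj₁; inj₂)
  open import Relation.Binary.Reasoning.Setoid polySetoid
  open import Algebra.Solver.Ring.NaturalCoefficients polySemiring (λ _ _ → nothing)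

  exponent-suc : ∀ n → suc n * (suc n ∸ 1) ≡ n * (n ∸ 1) + (n + n)
  exponent-suc zero = refl
  exponent-suc (suc n) = lemma n
    where
    lemma : ∀ n → suc (suc n) * suc n ≡ suc n * n + (suc n + suc n)
    lemma = solve-∀

  qint-split : ∀ k n → n ≤ k →
    pmul (q^ (n + n)) [ suc k ]² ≐ padd (pmul (q^ (n + n)) [ k ∸ n ]²) (pmul (q^ (k + k)) [ suc n ]²)
  qint-split k n n≤k = begin
    pmul z [ suc k ]²                                         ≡⟨ cong (λ e → pmul z [ e ]²) (sym r+n+1≡k+1) ⟩
    pmul z [ r + suc n ]²                                     ≈⟨ pmul-congʳ z ([]²-+ r (suc n)) ⟩
    pmul z (padd [ r ]² (pmul (q^ (r + r)) [ suc n ]²))       ≈⟨ pmul-distribˡ z [ r ]² _ ⟩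
    padd (pmul z [ r ]²) (pmul z (pmul (q^ (r + r)) [ suc n ]²))
                                                               ≈⟨ padd-congʳ (pmul z [ r ]²) (≐-sym (pmul-assoc z (q^ (r + r)) [ suc n ]²)) ⟩
    padd (pmul z [ r ]²) (pmul (pmul z (q^ (r + r))) [ suc n ]²)
                                                               ≈⟨ padd-congʳ (pmul z [ r ]²) (pmul-congˡ [ suc n ]² (≐-sym (q^-+ (n + n) (r + r)))) ⟩
    padd (pmul z [ r ]²) (pmul (q^ (n + n + (r + r))) [ suc n ]²)
                                                               ≡⟨ cong (λ e → padd (pmul z [ r ]²) (pmul (q^ e) [ suc n ]²)) 2n+2r≡2k ⟩
    padd (pmul z [ r ]²) (pmul (q^ (k + k)) [ suc n ]²)       ∎
    where
    r : ℕ
    r = k ∸ n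
    z : Poly
    z = q^ (n + n)
    r+n≡k : r + n ≡ k
    r+n≡k = ℕP.m∸n+n≡m n≤k
    r+n+1≡k+1 : r + suc n ≡ suc k
    r+n+1≡k+1 = trans (ℕP.+-suc r n) (cong suc r+n≡k)
    2n+2r≡2k : n + n + (r + r) ≡ k + k
    2n+2r≡2k = trans (lemma n r) (cong (λ u → u + u) r+n≡k)
      where
      lemma : ∀ n r → n + n + (r + r) ≡ (r + n) + (r + n)
      lemma = solve-∀

  G-identity : ∀ k n → k + k ≤ m → n ≤ k →
    pmul (G k n) (pmul (n !²) ((k ∸ n) !²)) ≐ pmul (q^ (n * (n ∸ 1))) (k !²)
  G-identity k zero _ _ = begin
    pmul (G k 0) (pmul (0 !²) (k !²))          ≈⟨ pmul-cong (G-0 k) (pmul-congˡ (k !²) 0!²) ⟩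
    pmul (1 ∷ []) (pmul (1 ∷ []) (k !²))        ≈⟨ pmul-identityˡ (pmul (1 ∷ []) (k !²)) ⟩
    pmul (1 ∷ []) (k !²)                        ∎
  G-identity (suc k) (suc n) 2k+2≤m (s≤s n≤k) = begin
    pmul (G (suc k) (suc n)) (pmul F₁ Fr)
      ≈⟨ pmul-congˡ (pmul F₁ Fr) (G-pascal k n 2k+1≤m) ⟩
    pmul (padd (pmul x A) B) (pmul F₁ Fr)
      ≈⟨ pmul-distribʳ (pmul x A) B (pmul F₁ Fr) ⟩
    padd (pmul (pmul x A) (pmul F₁ Fr)) (pmul B (pmul F₁ Fr))
      ≈⟨ padd-cong first-term second-term ⟩
    padd (pmul (pmul x Qn) (pmul y F)) (pmul (pmul Qr (pmul y z)) F)
      ≈⟨ solve 6 (λ x Qn y F Qr z → (x :* Qn) :* (y :* F) :+ (Qr :* (y :* z)) :* F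
                                  := (y :* F) :* (z :* Qr :+ x :* Qn)) ≐-refl x Qn y F Qr z ⟩
    pmul (pmul y F) (padd (pmul z Qr) (pmul x Qn))
      ≈⟨ pmul-congʳ (pmul y F) (≐-sym (qint-split k n n≤k)) ⟩
    pmul (pmul y F) (pmul z [ suc k ]²)
      ≈⟨ solve 4 (λ y F z Q → (y :* F) :* (z :* Q) := (y :* z) :* (F :* Q)) ≐-refl y F z [ suc k ]² ⟩
    pmul (pmul y z) (pmul F [ suc k ]²)
      ≈⟨ pmul-cong (≐-sym (q^-+ (n * (n ∸ 1)) (n + n))) (≐-sym (!²-suc k)) ⟩
    pmul (q^ (n * (n ∸ 1) + (n + n))) ((suc k) !²)
      ≡⟨ cong (λ e → pmul (q^ e) ((suc k) !²)) (sym (exponent-suc n)) ⟩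
    pmul (q^ (suc n * n)) ((suc k) !²) ∎
    where
    A B F F₁ Fn Fr Qn Qr x y z : Poly
    A = G k n
    B = G k (suc n)
    F = k !²
    F₁ = (suc n) !²
    Fn = n !²
    Fr = (k ∸ n) !²
    Qn = [ suc n ]²
    Qr = [ k ∸ n ]²
    x = q^ (k + k)
    y = q^ (n * (n ∸ 1))
    z = q^ (n + n)
    2k+1≤m : suc (k + k) ≤ m
    2k+1≤m = ℕP.≤-trans (ℕP.n≤1+n _) (subst (_≤ m) (cong suc (ℕP.+-suc k k)) 2k+2≤m)
    2k≤m : k + k ≤ m
    2k≤m = ℕP.≤-trans (ℕP.n≤1+n _) 2k+1≤m
    -- the subsets containing sq k
    first-term : pmul (pmul x A) (pmul F₁ Fr) ≐ pmul (pmul x Qn) (pmul y F)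
    first-term = begin
      pmul (pmul x A) (pmul F₁ Fr)            ≈⟨ pmul-congʳ (pmul x A) (pmul-congˡ Fr (!²-suc n)) ⟩
      pmul (pmul x A) (pmul (pmul Fn Qn) Fr)  ≈⟨ solve 5 (λ x A Fn Qn Fr → (x :* A) :* ((Fn :* Qn) :* Fr) := (x :* Qn) :* (A :* (Fn :* Fr))) ≐-refl x A Fn Qn Fr ⟩
      pmul (pmul x Qn) (pmul A (pmul Fn Fr))  ≈⟨ pmul-congʳ (pmul x Qn) (G-identity k n 2k≤m n≤k) ⟩
      pmul (pmul x Qn) (pmul y F)             ∎
    -- the subsets avoiding sq k (none if n = k)
    second-term : pmul B (pmul F₁ Fr) ≐ pmul (pmul Qr (pmul y z)) F
    second-term with ℕP.m≤n⇒m<n∨m≡n n≤k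
    ... | inj₁ n<k = begin
      pmul B (pmul F₁ Fr)                                ≈⟨ pmul-congʳ B (pmul-congʳ F₁ Fr≐) ⟩
      pmul B (pmul F₁ (pmul Fr′ Qr))                     ≈⟨ solve 4 (λ B F₁ Fr′ Qr → B :* (F₁ :* (Fr′ :* Qr)) := Qr :* (B :* (F₁ :* Fr′))) ≐-refl B F₁ Fr′ Qr ⟩
      pmul Qr (pmul B (pmul F₁ Fr′))                     ≈⟨ pmul-congʳ Qr (G-identity k (suc n) 2k≤m n<k) ⟩
      pmul Qr (pmul (q^ (suc n * n)) F)                  ≡⟨ cong (λ e → pmul Qr (pmul (q^ e) F)) (exponent-suc n) ⟩
      pmul Qr (pmul (q^ (n * (n ∸ 1) + (n + n))) F)      ≈⟨ pmul-congʳ Qr (pmul-congˡ F (q^-+ (n * (n ∸ 1)) (n + n))) ⟩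
      pmul Qr (pmul (pmul y z) F)                        ≈⟨ pmul-assoc Qr (pmul y z) F ⟨
      pmul (pmul Qr (pmul y z)) F                        ∎
      where
      Fr′ : Poly
      Fr′ = (k ∸ suc n) !²
      Fr≐ : Fr ≐ pmul Fr′ Qr
      Fr≐ = subst (λ e → e !² ≐ pmul Fr′ [ e ]²) (sym (ℕP.+-∸-assoc 1 n<k)) (!²-suc (k ∸ suc n))
    ... | inj₂ refl = begin
      pmul B (pmul F₁ Fr)                  ≈⟨ pmul-congˡ (pmul F₁ Fr) (G-vanish n (suc n) ℕP.≤-refl) ⟩
      []                                   ≡⟨ cong (λ e → pmul (pmul [ e ]² (pmul y z)) F) (ℕP.n∸n≡0 n) ⟨
      pmul (pmul Qr (pmul y z)) F          ∎

open import Data.Nat using (_*_; _∸_; _/_; _≤_; _<_)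
open import Data.Integer using (+_)
open import Data.List using (lookup)

module PoincareSeries (m n : ℕ) where

  open SpecialPlacements m
  open QBinomial m
  open Polynomials

  dimension : (d : ℕ → ℕ) → (∀ i → HasDim m n i (d i)) → ∀ i → d i ≡ pcoeff (G K n) i
  dimension d hasDim i with hasDim i
  ... | b , b-basis =
    trans (RankInvariance.basis-size-unique m n i b _ b-basis
             (HomologyBasis.basis m n i (special-list n i) (special-list-unique n i) (special-list⇔ n i)))
          (count-special n i)

  cleared : (d : ℕ → ℕ) → (∀ i → HasDim m n i (d i)) → n ≤ K →
    ∀ i → conv d (psq (pmul (qfact n) (qfact (K ∸ n)))) i ≡ pcoeff (pshift (n * (n ∸ 1)) (K !²)) i
  cleared d hasDim n≤K i = begin
    conv d (psq (pmul (qfact n) (qfact (K ∸ n)))) i                 ≡⟨ conv-pmul d (G K n) _ (dimension d hasDim) i ⟩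
    pcoeff (pmul (G K n) (psq (pmul (qfact n) (qfact (K ∸ n))))) i  ≡⟨ at (pmul-congʳ (G K n) (psq-pmul (qfact n) (qfact (K ∸ n)))) i ⟩
    pcoeff (pmul (G K n) (pmul (n !²) ((K ∸ n) !²))) i              ≡⟨ at (G-identity K n K+K≤m n≤K) i ⟩
    pcoeff (pmul (q^ (n * (n ∸ 1))) (K !²)) i                       ≡⟨ at (pshift-q^ (n * (n ∸ 1)) (K !²)) i ⟨
    pcoeff (pshift (n * (n ∸ 1)) (K !²)) i                          ∎
    where open ≡-Reasoning

  vanishing : (d : ℕ → ℕ) → (∀ i → HasDim m n i (d i)) → K < n → ∀ i → d i ≡ 0
  vanishing d hasDim K<n i = trans (dimension d hasDim i) (at (G-vanish K n K<n) i)

theorem8p7 : (m n : ℕ) →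
    ((i : ℕ) (L : List Placement) → Unique L → (∀ T → (T ∈ L) ⇔ Special m n i T) →
      IsHomologyBasis m n i (λ k → (+ 1 , lookup L k) ∷ []))
    × ((d : ℕ → ℕ) → (∀ i → HasDim m n i (d i)) →
      SeriesIsQBinom d (n * (n ∸ 1)) (m / 2) n)
theorem8p7 m n =
  (λ i L unique char → HomologyBasis.basis m n i L unique char) ,
  (λ d hasDim → PoincareSeries.cleared m n d hasDim , PoincareSeries.vanishing m n d hasDim)
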